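{- Let $\pi\in S_k$ be a layered permutation, and let $\ell$ be the number of non-final layers of $\pi$ of size at least $2$. Then (1) $g(\pi,n)=\Theta\left((\log n)^{k-\ell-1}\right)$ as $n\to\infty$; (2) $P(\pi,r)=\Theta\left(r(\log r)^{k-\ell-1}\right)$ as $r\to\infty$.
   Context: A layered permutation $\pi\in S_k$ is one obtained from the descending permutation $k,k-1,\dots,1$ by reversing some of its contiguous blocks (descending runs), so that $\pi$ is a concatenation of increasing runs of consecutive values, each run consisting of values larger than all values in later runs. A layer is a maximal contiguous ascending run of $\pi$; its size is its number of entries; a non-final layer is a layer that is not at the end of $\pi$. (E.g. $789623451$ has layers $789,6,2345,1$.) A $\pi$-wave is an increasing sequence of integers $x_1<\cdots<x_{k+1}$ such that for all $1\le i,j\le k$, $x_{i+1}-x_i > x_{j+1}-x_j$ if and only if $\pi(i)>\pi(j)$. $g(\pi,n)$ is the largest cardinality of a subset of $[n]=\{1,\dots,n\}$ containing no $\pi$-wave. $P(\pi,r)$ is the least positive integer $M$ such that every $r$-coloring of $[M]$ contains a monochromatic $\pi$-wave. Implied constants may depend on $\pi$. -}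

module Defs where

open import Data.Nat using (ℕ; zero; suc; _+_; _*_; _∸_; _^_; _≤_; _<_; _≤?_)
open import Data.Nat.Logarithm using (⌊log₂_⌋)
open import Data.Fin using (Fin; toℕ; inject₁)
import Data.Fin as F
open import Data.Fin.Subset using (Subset; _∈_; ∣_∣)
open import Data.List using (List; []; _∷_)
open import Data.Nat.ListAction using (sum)
open import Data.Vec using (Vec; tabulate; _++_; lookup)
open import Data.Product using (Σ; ∃; _×_)
open import Data.Bool using (if_then_else_)
open import Relation.Nullary using (¬_; does)
open import Function.Bundles using (_⇔_)

-- A layered permutation is determined by its list of layer sizes (a composition
-- of k).  Given sizes s₁,…,s_m (all ≥ 1), the permutation, in one-line notation
-- with values 1..k, is the concatenation of ascending runs of consecutive values,
-- each run using values larger than all later runs.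
layered : (ss : List ℕ) → Vec ℕ (sum ss)
layered []       = Data.Vec.[]
layered (s ∷ ss) = tabulate (λ (i : Fin s) → sum ss + suc (toℕ i)) ++ layered ss

nonFinalBig : List ℕ → ℕ
nonFinalBig []           = 0
nonFinalBig (s ∷ [])     = 0
nonFinalBig (s ∷ t ∷ ts) = (if does (2 ≤? s) then 1 else 0) + nonFinalBig (t ∷ ts)

gap : ∀ {k m} → (Fin (suc k) → Fin m) → Fin k → ℕ
gap x i = toℕ (x (F.suc i)) ∸ toℕ (x (inject₁ i))

-- [n] = {1,…,n} is represented by Fin n (element i stands for i+1);
-- this shift does not affect gaps.
IsWave : ∀ {k m} → Vec ℕ k → (Fin (suc k) → Fin m) → Set
IsWave {k} π x =
  (∀ (i : Fin k) → toℕ (x (inject₁ i)) < toℕ (x (F.suc i))) ×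
  (∀ (i j : Fin k) → (gap x j < gap x i) ⇔ (lookup π j < lookup π i))

ContainsWave : ∀ {k n} → Vec ℕ k → Subset n → Set
ContainsWave {k} {n} π A =
  Σ (Fin (suc k) → Fin n) λ x → IsWave π x × (∀ i → x i ∈ A)

WaveFree : ∀ {k n} → Vec ℕ k → Subset n → Set
WaveFree π A = ¬ ContainsWave π A

MonoWave : ∀ {k M r} → Vec ℕ k → (Fin M → Fin r) → Set
MonoWave {k} {M} π col =
  Σ (Fin (suc k) → Fin M) λ x → IsWave π x × (∀ i → col (x i) ≡ col (x F.zero))
  where open import Relation.Binary.PropositionalEquality using (_≡_)

-- Upper bound: the layers are treated from first to last. For a layer of size 1, one of the
-- log n dyadic annuli around min A contains a fraction 1/log n of A, and a wave for the
-- remaining layers in that annulus is preceded by min A. For a layer of size s ≥ 2, view A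
-- from its maximum b, recurse into the annuli {x ∈ A : 2^w ≤ b − x < 2^(w+1)}, and give x the
-- path (w₁,b₁), (w₂,b₂), … of the maxima it is seen from, innermost first; the gaps of
-- x < b₁ < b₂ < ⋯ increase. Say that T is the size that forces a wave for the remaining
-- layers. If four points of A lie far apart in the recursion but share w₁, …, w₍ₛ₋₁₎, then
-- the sequence x < b₁ < ⋯ < b₍ₛ₋₁₎ of the lowest one can be followed by a block of T elements
-- next to the highest one: the block has diameter less than 2^w₁, and the second and
-- third points make the gap before it larger than b₍ₛ₋₁₎ − b₍ₛ₋₂₎. So |A| = O(T (log n)^(s−1)),
-- although a layer of size s contributes s gaps.
--
-- Lower bound: exponentially departing copies of a set deal with a layer of size 1;
-- iterating s − 1 times the construction of exponentially approaching copies deals with a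
-- layer of size s, since an ascending run of s gaps then starts inside an innermost copy,
-- which confines the later, smaller gaps to one copy. These sets avoid even waves with
-- weakly ordered gaps, so they can be scaled by 2|A| and perturbed to contain every residue
-- modulo |A| once; their translates by multiples of |A| then color an interval.

{-# OPTIONS --safe #-}
module Submission where

open import Defs
open import Data.Nat using (ℕ; zero; suc; _+_; _*_; _∸_; _^_; _≤_; _<_; _>_; _≤?_; _<?_; _≟_; z≤n; s≤s; NonZero; >-nonZero; _/_; _%_)
open import Data.Nat.Properties
open import Data.Nat.DivMod using (_mod_; m≡m%n+[m/n]*n; m%n<n; m<n*o⇒m/o<n; m/n*n≤m; m≥n⇒m/n>0)
open import Data.Nat.Induction using (<-rec)
open import Data.Nat.Logarithm using (⌊log₂_⌋; ⌊log₂⌋-mono-≤; ⌊log₂[2^n]⌋≡n; ⌊log₂⌊n/2⌋⌋≡⌊log₂n⌋∸1)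
open import Data.Nat.ListAction using (sum)
open import Data.Nat.Tactic.RingSolver using (solve-∀)
open import Data.Bool using (true; false)
open import Data.Empty using (⊥; ⊥-elim)
open import Data.Unit using (⊤; tt)
open import Data.Fin using (Fin; toℕ; fromℕ<; inject₁; splitAt; remQuot; combine; _↑ˡ_; _↑ʳ_)
import Data.Fin as Fin
open import Data.Fin.Properties using (toℕ<n; toℕ-fromℕ<; toℕ-inject₁; toℕ-injective; toℕ-↑ˡ; toℕ-↑ʳ; combine-remQuot; splitAt⁻¹-↑ˡ; splitAt⁻¹-↑ʳ) renaming (suc-injective to Fin-suc-injective; 0≢1+n to Fin-0≢1+n)
open import Data.Fin.Subset using (Subset; ∣_∣)
import Data.Fin.Subset as Subset
open import Data.Fin.Subset.Properties using (∣⊤∣≡n; ∣⊥∣≡0; ∉⊥)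
open import Data.List using (List; []; _∷_; _++_; length; map; filter; take; drop)
open import Data.List.Properties using (length-++; length-take; length-drop; take++drop≡id; length-map; ∷ʳ-++)
open import Data.List.Membership.Propositional using (_∈_)
open import Data.List.Membership.Propositional.Properties using (∈-filter⁻; ∈-++⁺ˡ; ∈-++⁺ʳ; ∈-++⁻; ∈-map⁻)
open import Data.List.Relation.Unary.All using (All; []; _∷_)
import Data.List.Relation.Unary.All as All
import Data.List.Relation.Unary.All.Properties as All
open import Data.List.Relation.Unary.Any using (here; there)
open import Data.List.Relation.Unary.AllPairs using (AllPairs; []; _∷_)
import Data.List.Relation.Unary.AllPairs as AllPairs
import Data.List.Relation.Unary.AllPairs.Properties as AllPairs
open import Data.Product using (Σ; _×_; _,_; proj₁; proj₂)
open import Data.Sum using (_⊎_; inj₁; inj₂)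
open import Data.Vec using (Vec; []; _∷_; here; there; lookup; tabulate)
open import Data.Vec.Properties using (lookup-++ˡ; lookup-++ʳ; lookup∘tabulate)
open import Function using (_∘_)
open import Function.Bundles using (mk⇔; Equivalence)
open import Relation.Binary.Definitions using (tri<; tri≈; tri>)
open import Relation.Binary.PropositionalEquality using (_≡_; _≢_; refl; sym; trans; cong; cong₂; subst; subst₂; module ≡-Reasoning)
open import Relation.Nullary using (¬_; yes; no; does)
open import Relation.Unary using (Decidable)
open import Relation.Unary.Properties using (∁?)

-- Layered waves as sequences of naturals

-- A certificate for linear arithmetic: `l ≤ r` is the sum of the hypotheses, `k` the slack, and the
-- remaining identity is left to the ring solver.
lin-≤ : ∀ k {a b l r} → l ≤ r → a + r + k ≡ b + l → a ≤ b
lin-≤ k {a} {b} {l} {r} l≤r eq = +-cancelʳ-≤ r a b (begin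
  a + r      ≤⟨ m≤m+n (a + r) k ⟩
  a + r + k  ≡⟨ eq ⟩
  b + l      ≤⟨ +-monoʳ-≤ b l≤r ⟩
  b + r      ∎)
  where open ≤-Reasoning

Δ : (ℕ → ℕ) → ℕ → ℕ
Δ x i = x (suc i) ∸ x i

Increasing : ℕ → (ℕ → ℕ) → Set
Increasing k x = ∀ i → i < k → x i < x (suc i)

increasing-mono : ∀ {k x} → Increasing k x → ∀ i → i ≤ k → x 0 ≤ x i
increasing-mono inc zero    _    = ≤-refl
increasing-mono inc (suc i) i<k =
  ≤-trans (increasing-mono inc i (≤-trans (n≤1+n i) i<k)) (<⇒≤ (inc i i<k))

-- Only comparisons of consecutive gaps within a layer, and of the first gap of a
-- layer with all later ones, are recorded: the remaining ones follow when _R_ is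
-- transitive.
GapOrder : (ℕ → ℕ → Set) → List ℕ → (ℕ → ℕ) → Set
GapOrder _R_ []       g = ⊤
GapOrder _R_ (s ∷ ss) g =
  (∀ i → suc i < s → g i R g (suc i)) ×
  (∀ j → j < sum ss → g (s + j) R g 0) ×
  GapOrder _R_ ss (λ j → g (s + j))

GapOrder-cong : ∀ {R : ℕ → ℕ → Set} ss {g h} → (∀ i → i < sum ss → g i ≡ h i) →
  GapOrder R ss g → GapOrder R ss h
GapOrder-cong []       eq _ = tt
GapOrder-cong {R} (s ∷ ss) eq (asc , low , rest) =
  (λ i i<s → subst₂ R (eq i (≤-trans (<⇒≤ i<s) (m≤m+n s _)))
                      (eq (suc i) (≤-trans i<s (m≤m+n s _))) (asc i i<s)) ,
  (λ j j< → subst₂ R (eq _ (+-monoʳ-< s j<))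
                     (eq 0 (≤-<-trans z≤n (+-monoʳ-< s j<))) (low j j<)) ,
  GapOrder-cong ss (λ j j< → eq _ (+-monoʳ-< s j<)) rest

Respects : ∀ {k} → (ℕ → ℕ → Set) → Vec ℕ k → (Fin k → ℕ) → Set
Respects _R_ π g = ∀ i j → lookup π j < lookup π i → g j R g i

layered-≤ : ∀ ss i → lookup (layered ss) i ≤ sum ss
layered-≤ (s ∷ ss) i with splitAt s i in eq
... | inj₁ a rewrite sym (splitAt⁻¹-↑ˡ eq)
                   | lookup-++ˡ (tabulate λ (i : Fin s) → sum ss + suc (toℕ i)) (layered ss) a
                   | lookup∘tabulate (λ (i : Fin s) → sum ss + suc (toℕ i)) a
                   = ≤-trans (+-monoʳ-≤ (sum ss) (toℕ<n a)) (≤-reflexive (+-comm (sum ss) s))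
... | inj₂ b rewrite sym (splitAt⁻¹-↑ʳ {m = s} eq)
                   | lookup-++ʳ (tabulate λ (i : Fin s) → sum ss + suc (toℕ i)) (layered ss) b
                   = ≤-trans (layered-≤ ss b) (m≤n+m _ s)

module _ (s : ℕ) (ss : List ℕ) where

  layered-first : ∀ a → lookup (layered (s ∷ ss)) (a ↑ˡ sum ss) ≡ sum ss + suc (toℕ a)
  layered-first a = trans (lookup-++ˡ (tabulate λ (i : Fin s) → sum ss + suc (toℕ i)) _ a)
                          (lookup∘tabulate _ a)

  layered-rest : ∀ b → lookup (layered (s ∷ ss)) (s ↑ʳ b) ≡ lookup (layered ss) b
  layered-rest = lookup-++ʳ (tabulate λ (i : Fin s) → sum ss + suc (toℕ i)) _

  layered-rest<first : ∀ a b →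
    lookup (layered (s ∷ ss)) (s ↑ʳ b) < lookup (layered (s ∷ ss)) (a ↑ˡ sum ss)
  layered-rest<first a b rewrite layered-first a | layered-rest b =
    ≤-<-trans (layered-≤ ss b) (m<m+n _ (s≤s z≤n))

layered-injective : ∀ ss i j → lookup (layered ss) i ≡ lookup (layered ss) j → i ≡ j
layered-injective (s ∷ ss) i j eq with splitAt s i in eqi | splitAt s j in eqj
... | inj₁ a | inj₁ b rewrite sym (splitAt⁻¹-↑ˡ eqi) | sym (splitAt⁻¹-↑ˡ eqj)
                            | layered-first s ss a | layered-first s ss b =
  cong (_↑ˡ sum ss) (toℕ-injective (suc-injective (+-cancelˡ-≡ (sum ss) _ _ eq)))
... | inj₁ a | inj₂ b rewrite sym (splitAt⁻¹-↑ˡ eqi) | sym (splitAt⁻¹-↑ʳ {m = s} eqj) =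
  ⊥-elim (<-irrefl (sym eq) (layered-rest<first s ss a b))
... | inj₂ a | inj₁ b rewrite sym (splitAt⁻¹-↑ʳ {m = s} eqi) | sym (splitAt⁻¹-↑ˡ eqj) =
  ⊥-elim (<-irrefl eq (layered-rest<first s ss b a))
... | inj₂ a | inj₂ b rewrite sym (splitAt⁻¹-↑ʳ {m = s} eqi) | sym (splitAt⁻¹-↑ʳ {m = s} eqj)
                            | layered-rest s ss a | layered-rest s ss b =
  cong (s ↑ʳ_) (layered-injective ss a b eq)

Respects⇒GapOrder : ∀ {R : ℕ → ℕ → Set} ss (g : ℕ → ℕ) → All (1 ≤_) ss →
  Respects R (layered ss) (g ∘ toℕ) → GapOrder R ss g
Respects⇒GapOrder [] g _ resp = tt
Respects⇒GapOrder {R} (s ∷ ss) g (1≤s ∷ ps) resp = asc , low , rest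
  where
  first : ∀ {i} (i<s : i < s) → toℕ (fromℕ< i<s ↑ˡ sum ss) ≡ i
  first i<s = trans (toℕ-↑ˡ (fromℕ< i<s) (sum ss)) (toℕ-fromℕ< i<s)
  asc : ∀ i → suc i < s → R (g i) (g (suc i))
  asc i i<s = subst₂ (λ a b → R (g a) (g b)) (first (<⇒≤ i<s)) (first i<s)
    (resp (fromℕ< i<s ↑ˡ sum ss) (fromℕ< (<⇒≤ i<s) ↑ˡ sum ss)
      (subst₂ _<_ (sym (layered-first s ss (fromℕ< (<⇒≤ i<s)))) (sym (layered-first s ss (fromℕ< i<s)))
        (+-monoʳ-< (sum ss) (s≤s (subst₂ _<_ (sym (toℕ-fromℕ< (<⇒≤ i<s))) (sym (toℕ-fromℕ< i<s)) ≤-refl)))))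
  low : ∀ j → j < sum ss → R (g (s + j)) (g 0)
  low j j< = subst₂ (λ a b → R (g a) (g b))
    (trans (toℕ-↑ʳ s (fromℕ< j<)) (cong (s +_) (toℕ-fromℕ< j<))) (first 1≤s)
    (resp (fromℕ< 1≤s ↑ˡ sum ss) (s ↑ʳ fromℕ< j<) (layered-rest<first s ss (fromℕ< 1≤s) (fromℕ< j<)))
  rest : GapOrder R ss (λ j → g (s + j))
  rest = Respects⇒GapOrder ss _ ps λ i j j<i →
    subst₂ (λ a b → R (g a) (g b)) (toℕ-↑ʳ s j) (toℕ-↑ʳ s i)
      (resp (s ↑ʳ i) (s ↑ʳ j)
        (subst₂ _<_ (sym (layered-rest s ss j)) (sym (layered-rest s ss i)) j<i))

ascending-< : ∀ {s} {g : ℕ → ℕ} → (∀ i → suc i < s → g i < g (suc i)) →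
  ∀ i j → i < j → j < s → g i < g j
ascending-< asc i (suc j) (s≤s i≤j) j<s with m≤n⇒m<n∨m≡n i≤j
... | inj₁ i<j  = <-trans (ascending-< asc i j i<j (<⇒≤ j<s)) (asc j j<s)
... | inj₂ refl = asc i j<s

ascending-≤ : ∀ {s} {g : ℕ → ℕ} → (∀ i → suc i < s → g i < g (suc i)) →
  ∀ i → i < s → g 0 ≤ g i
ascending-≤ asc zero    _   = ≤-refl
ascending-≤ asc (suc i) i<s = <⇒≤ (ascending-< asc 0 (suc i) (s≤s z≤n) i<s)

-- Within a layer, consecutive comparisons are chained; across layers, a later gap is below the
-- first gap of the earlier layer, which is the smallest of that layer.
GapOrder⇒Respects : ∀ ss (g : ℕ → ℕ) → GapOrder _<_ ss g → Respects _<_ (layered ss) (g ∘ toℕ)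
GapOrder⇒Respects (s ∷ ss) g (asc , low , rest) i j j<i with splitAt s i in eqi | splitAt s j in eqj
... | inj₁ a | inj₁ b rewrite sym (splitAt⁻¹-↑ˡ eqi) | sym (splitAt⁻¹-↑ˡ eqj)
                            | layered-first s ss a | layered-first s ss b
                            | toℕ-↑ˡ a (sum ss) | toℕ-↑ˡ b (sum ss) =
  ascending-< asc (toℕ b) (toℕ a) (≤-pred (+-cancelˡ-< (sum ss) _ _ j<i)) (toℕ<n a)
... | inj₁ a | inj₂ b rewrite sym (splitAt⁻¹-↑ˡ eqi) | sym (splitAt⁻¹-↑ʳ {m = s} eqj)
                            | toℕ-↑ˡ a (sum ss) | toℕ-↑ʳ s b =
  <-≤-trans (low (toℕ b) (toℕ<n b)) (ascending-≤ asc (toℕ a) (toℕ<n a))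
... | inj₂ a | inj₁ b rewrite sym (splitAt⁻¹-↑ʳ {m = s} eqi) | sym (splitAt⁻¹-↑ˡ eqj) =
  ⊥-elim (<-asym j<i (layered-rest<first s ss b a))
... | inj₂ a | inj₂ b rewrite sym (splitAt⁻¹-↑ʳ {m = s} eqi) | sym (splitAt⁻¹-↑ʳ {m = s} eqj)
                            | layered-rest s ss a | layered-rest s ss b
                            | toℕ-↑ʳ s a | toℕ-↑ʳ s b =
  GapOrder⇒Respects ss (λ j → g (s + j)) rest a b j<i

-- The relation is a parameter because the upper bound builds waves with strictly ordered gaps,
-- while the lower bound excludes even weakly ordered ones.
record Wave (_R_ : ℕ → ℕ → Set) (ss : List ℕ) (P : ℕ → Set) (x : ℕ → ℕ) : Set where
  constructor wave
  field
    mem      : ∀ i → i ≤ sum ss → P (x i)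
    inc      : Increasing (sum ss) x
    gapOrder : GapOrder _R_ ss (Δ x)
open Wave

extend : ∀ {k} → (Fin (suc k) → ℕ) → ℕ → ℕ
extend         f zero    = f Fin.zero
-- Past the end the last value repeats; `Wave` inspects only indices up to `sum ss`.
extend {zero}  f (suc i) = f Fin.zero
extend {suc k} f (suc i) = extend (f ∘ Fin.suc) i

extend-toℕ : ∀ {k} (f : Fin (suc k) → ℕ) i → extend f (toℕ i) ≡ f i
extend-toℕ         f Fin.zero    = refl
extend-toℕ {suc k} f (Fin.suc i) = extend-toℕ (f ∘ Fin.suc) i

extend-Δ : ∀ {k} (f : Fin (suc k) → ℕ) (i : Fin k) →
  Δ (extend f) (toℕ i) ≡ f (Fin.suc i) ∸ f (inject₁ i)
extend-Δ f i = cong₂ _∸_ (extend-toℕ f (Fin.suc i))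
  (trans (cong (extend f) (sym (toℕ-inject₁ i))) (extend-toℕ f (inject₁ i)))

extend-wave : ∀ {R : ℕ → ℕ → Set} {P : ℕ → Set} ss (f : Fin (suc (sum ss)) → ℕ) → All (1 ≤_) ss →
  (∀ i → P (f i)) → (∀ i → f (inject₁ i) < f (Fin.suc i)) →
  Respects R (layered ss) (λ i → f (Fin.suc i) ∸ f (inject₁ i)) →
  Wave R ss P (extend f)
extend-wave {R} {P} ss f ps Pf inc< resp = wave
  (λ i i≤ → subst (P ∘ extend f) (toℕ-fromℕ< (s≤s i≤))
    (subst P (sym (extend-toℕ f (fromℕ< (s≤s i≤)))) (Pf (fromℕ< (s≤s i≤)))))
  (λ i i< → let j = fromℕ< i< in
    subst (λ a → extend f a < extend f (suc a)) (toℕ-fromℕ< i<)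
      (subst₂ _<_ (trans (sym (extend-toℕ f (inject₁ j))) (cong (extend f) (toℕ-inject₁ j)))
        (sym (extend-toℕ f (Fin.suc j))) (inc< j)))
  (Respects⇒GapOrder ss _ ps λ i j j<i →
    subst₂ R (sym (extend-Δ f j)) (sym (extend-Δ f i)) (resp i j j<i))

wave⇒IsWave : ∀ {n P x} ss → Wave _<_ ss P x → (x<n : ∀ i → i ≤ sum ss → x i < n) →
  IsWave (layered ss) (λ (i : Fin (suc (sum ss))) → fromℕ< (x<n (toℕ i) (≤-pred (toℕ<n i))))
wave⇒IsWave {n} {P} {x} ss w x<n = inc′ , λ i j → mk⇔ (reflects i j) (resp i j)
  where
  y : Fin (suc (sum ss)) → Fin n
  y i = fromℕ< (x<n (toℕ i) (≤-pred (toℕ<n i)))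
  y-inject₁ : ∀ (i : Fin (sum ss)) → toℕ (y (inject₁ i)) ≡ x (toℕ i)
  y-inject₁ i = trans (toℕ-fromℕ< (x<n (toℕ (inject₁ i)) (≤-pred (toℕ<n (inject₁ i))))) (cong x (toℕ-inject₁ i))
  y-suc : ∀ (i : Fin (sum ss)) → toℕ (y (Fin.suc i)) ≡ x (suc (toℕ i))
  y-suc i = toℕ-fromℕ< (x<n (suc (toℕ i)) (toℕ<n i))
  inc′ : ∀ i → toℕ (y (inject₁ i)) < toℕ (y (Fin.suc i))
  inc′ i = subst₂ _<_ (sym (y-inject₁ i)) (sym (y-suc i)) (inc w (toℕ i) (toℕ<n i))
  gap≡ : ∀ (i : Fin (sum ss)) → Δ x (toℕ i) ≡ gap y i
  gap≡ i = cong₂ _∸_ (sym (y-suc i)) (sym (y-inject₁ i))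
  resp : ∀ i j → lookup (layered ss) j < lookup (layered ss) i → gap y j < gap y i
  resp i j j<i = subst₂ _<_ (gap≡ j) (gap≡ i) (GapOrder⇒Respects ss (Δ x) (gapOrder w) i j j<i)
  -- The converse follows by trichotomy: equal entries force equal indices, and the reversed order
  -- contradicts `resp`.
  reflects : ∀ i j → gap y j < gap y i → lookup (layered ss) j < lookup (layered ss) i
  reflects i j gj<gi with <-cmp (lookup (layered ss) j) (lookup (layered ss) i)
  ... | tri< j<i _ _ = j<i
  ... | tri≈ _ eq _ with refl ← layered-injective ss j i eq = ⊥-elim (<-irrefl refl gj<gi)
  ... | tri> _ _ i<j = ⊥-elim (<-asym gj<gi (resp j i i<j))

-- Upper bound: nested annuli

Sorted : List ℕ → Set
Sorted = AllPairs _>_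

Within : List ℕ → ℕ → Set
Within xs d = ∀ {y z} → y ∈ xs → z ∈ xs → z < y + d

length-filter-∁ : ∀ {A : Set} {P : A → Set} (P? : Decidable P) xs →
  length (filter P? xs) + length (filter (∁? P?) xs) ≡ length xs
length-filter-∁ P? []       = refl
length-filter-∁ P? (x ∷ xs) with does (P? x)
... | true  = cong suc (length-filter-∁ P? xs)
... | false = trans (+-suc _ _) (cong suc (length-filter-∁ P? xs))

∈-take : ∀ n {x : ℕ} xs → x ∈ take n xs → x ∈ xs
∈-take n {x} xs x∈ = subst (x ∈_) (take++drop≡id n xs) (∈-++⁺ˡ x∈)

∈-drop : ∀ n {x : ℕ} xs → x ∈ drop n xs → x ∈ xs
∈-drop n {x} xs x∈ = subst (x ∈_) (take++drop≡id n xs) (∈-++⁺ʳ (take n xs) x∈)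

take>drop : ∀ n {x y xs} → Sorted xs → x ∈ take n xs → y ∈ drop n xs → y < x
take>drop (suc n) {xs = x ∷ xs} (x> ∷ _)  (here refl) y∈ = All.lookup x> (∈-drop n xs y∈)
take>drop (suc n) {xs = x ∷ xs} (_ ∷ s) (there x∈)  y∈ = take>drop n s x∈ y∈

2^suc : ∀ w → 2 ^ suc w ≡ 2 ^ w + 2 ^ w
2^suc w = cong (2 ^ w +_) (+-identityʳ (2 ^ w))

near-within : ∀ {b y z} w → b < y + 2 ^ w → z ≤ b → z < y + 2 ^ w
near-within w b<y+ z≤b = ≤-<-trans z≤b b<y+

far-within : ∀ {b y z} w → z + 2 ^ w ≤ b → b < y + 2 ^ suc w → z < y + 2 ^ w
far-within {b} {y} {z} w z+≤b b<y+ = lin-≤ 0 (≤-trans (s≤s z+≤b) (≤-trans b<y+ (≤-reflexive (cong (y +_) (2^suc w)))))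
  (eq y z (2 ^ w))
  where
  eq : ∀ y z e → suc z + (y + (e + e)) + 0 ≡ y + e + suc (z + e)
  eq = solve-∀

Path : Set
Path = List (ℕ × ℕ)

-- The gap before each maximum lies in the dyadic interval [2^w, 2^(w+1)) and the exponents increase
-- outwards, so successive gaps increase strictly.
Chain : ℕ → Path → Set
Chain x []            = ⊤
Chain x ((w , b) ∷ p) =
  (x + 2 ^ w ≤ b) × (b < x + 2 ^ suc w) × All (λ q → w < proj₁ q) p × Chain b p

record Block (P : ℕ → Set) (T w x : ℕ) : Set where
  constructor block
  field
    elems  : List ℕ
    sorted : Sorted elems
    inside : ∀ {y} → y ∈ elems → P y
    large  : T ≤ length elems
    above  : ∀ {y} → y ∈ elems → x < y
    within : Within elems (2 ^ w)

-- Only the innermost exponent counts: it belongs to the first and smallest gap of the layer, which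
-- has to dominate all gaps inside the block.
Blocked : (ℕ → Set) → ℕ → ℕ → Path → Set
Blocked P T x []            = ⊤
Blocked P T x ((w , _) ∷ _) = Block P T w x

Entry : Set
Entry = ℕ × Path

-- The first entry is the higher one. At `q` the second path leaves the first, visible in an
-- exponent that the first path lacks; the steps `α`, taken deeper in the recursion, have their
-- maxima below `x`.
Splits : Entry → Entry → Set
Splits (x , p) (_ , p′) = Σ Path λ α → Σ (ℕ × ℕ) λ q → Σ Path λ β →
  p′ ≡ α ++ q ∷ β × All (λ r → proj₁ r ≢ proj₁ q) p × All (λ r → proj₂ r < x) α

record Good (P : ℕ → Set) (T f : ℕ) (V : List ℕ) (pre : Path) (e : Entry) : Set where
  constructor good
  field
    mem     : proj₁ e ∈ V
    local   : Path
    decomp  : proj₂ e ≡ local ++ pre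
    bounds  : All (λ q → proj₁ q < f × proj₂ q ∈ V) local
    chain   : Chain (proj₁ e) (proj₂ e)
    blocked : Blocked P T (proj₁ e) (proj₂ e)
    ends    : All (P ∘ proj₂) (proj₂ e)

module Tree (P : ℕ → Set) (T : ℕ) (0<T : 0 < T) where

  record Node (f : ℕ) (V : List ℕ) (pre : Path) : Set where
    field
      sorted  : Sorted V
      inside  : ∀ {x} → x ∈ V → P x
      within  : Within V (2 ^ f)
      chain   : ∀ {x} → x ∈ V → Chain x pre
      blocked : ∀ {x} → x ∈ V → Blocked P T x pre
      ends    : All (P ∘ proj₂) pre
      coarse  : All (λ q → f ≤ proj₁ q) pre

  -- `covers` charges at most `T + T` elements of `V` to each entry, so a large set yields many
  -- entries.
  record Entries (f : ℕ) (V : List ℕ) (pre : Path) : Set where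
    constructor entries
    field
      list    : List Entry
      goods   : All (Good P T f V pre) list
      splits  : AllPairs Splits list
      covers  : length V ≤ (T + T) * length list

  leaf : ∀ {f b V pre} → Node f (b ∷ V) pre → Good P T f (b ∷ V) pre (b , pre)
  leaf nd = good (here refl) [] refl [] (chain (here refl)) (blocked (here refl)) ends
    where open Node nd

  short-within : ∀ {V} → Sorted V → Within V 1 → length V ≤ 1
  short-within []                         _  = z≤n
  short-within (_ ∷ [])                   _  = s≤s z≤n
  short-within {x ∷ y ∷ V} ((y<x ∷ _) ∷ _) wi =
    ⊥-elim (<-irrefl refl (<-≤-trans (wi (there (here refl)) (here refl))
      (≤-trans (≤-reflexive (+-comm y 1)) y<x)))

  -- Elements of V at distance ≥ 2^w from its maximum b become a child reached by the
  -- step (w , b), the others stay with b; a block of T elements above the child and of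
  -- diameter < 2^w is available if the near part is large, and is otherwise cut off
  -- from the top of the far part.
  build : ∀ f V pre → Node f V pre → Entries f V pre
  build f [] pre nd = entries [] [] [] z≤n
  build f (b ∷ V′) pre nd with length (b ∷ V′) ≤? T + T
  build f (b ∷ V′) pre nd | yes small =
    entries ((b , pre) ∷ []) (leaf nd ∷ []) ([] ∷ []) (≤-trans small (≤-reflexive (sym (*-identityʳ (T + T)))))
  build zero (b ∷ V′) pre nd | no big =
    ⊥-elim (big (≤-trans (short-within (Node.sorted nd) (Node.within nd)) (≤-trans 0<T (m≤m+n T T))))
  build (suc w) (b ∷ V′) pre nd | no big = cases (T ≤? length near)
    where
    open Node nd
    V near far : List ℕ
    V = b ∷ V′
    near? : Decidable (λ x → b < x + 2 ^ w)
    near? x = b <? x + 2 ^ w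
    near = filter near? V
    far  = filter (∁? near?) V

    V≤b : ∀ {x} → x ∈ V → x ≤ b
    V≤b (here refl) = ≤-refl
    V≤b (there x∈) with sorted
    ... | b> ∷ _ = <⇒≤ (All.lookup b> x∈)

    near⊆ : ∀ {x} → x ∈ near → x ∈ V
    near⊆ = proj₁ ∘ ∈-filter⁻ near? {xs = V}
    near-close : ∀ {x} → x ∈ near → b < x + 2 ^ w
    near-close = proj₂ ∘ ∈-filter⁻ near? {xs = V}
    far⊆ : ∀ {x} → x ∈ far → x ∈ V
    far⊆ = proj₁ ∘ ∈-filter⁻ (∁? near?) {xs = V}
    far-dist : ∀ {x} → x ∈ far → x + 2 ^ w ≤ b
    far-dist = ≮⇒≥ ∘ proj₂ ∘ ∈-filter⁻ (∁? near?) {xs = V}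
    far<near : ∀ {x y} → x ∈ far → y ∈ near → x < y
    far<near x∈ y∈ = +-cancelʳ-< (2 ^ w) _ _ (≤-<-trans (far-dist x∈) (near-close y∈))
    far<b : ∀ {x} → x ∈ far → x < b
    far<b {x} x∈ = <-≤-trans (m<m+n x (m^n>0 2 w)) (far-dist x∈)

    near+far : length near + length far ≡ length V
    near+far = length-filter-∁ near? V

    Within-near : Within near (2 ^ w)
    Within-near y∈ z∈ = near-within w (near-close y∈) (V≤b (near⊆ z∈))

    Within-far : Within far (2 ^ w)
    Within-far y∈ z∈ = far-within w (far-dist z∈) (within (far⊆ y∈) (here refl))

    finer : All (λ q → w ≤ proj₁ q) pre
    finer = All.map (≤-trans (n≤1+n w)) coarse

    nearNode : Node w near pre
    nearNode = record
      { sorted = AllPairs.filter⁺ near? sorted ; inside = inside ∘ near⊆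
      ; within = Within-near ; chain = chain ∘ near⊆ ; blocked = blocked ∘ near⊆
      ; ends = ends ; coarse = finer }

    farNode : ∀ {F} → Sorted F → (∀ {x} → x ∈ F → x ∈ far) → (∀ {x} → x ∈ F → Block P T w x) →
      Node w F ((w , b) ∷ pre)
    farNode sF F⊆ bF = record
      { sorted = sF ; inside = inside ∘ far⊆ ∘ F⊆
      ; within = λ y∈ z∈ → Within-far (F⊆ y∈) (F⊆ z∈)
      ; chain = λ x∈ → far-dist (F⊆ x∈) , within (far⊆ (F⊆ x∈)) (here refl) , coarse , chain (here refl)
      ; blocked = bF ; ends = inside (here refl) ∷ ends ; coarse = ≤-refl ∷ finer }

    widen : ∀ {F e} → (∀ {x} → x ∈ F → x ∈ V) → Good P T w F pre e → Good P T (suc w) V pre e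
    widen F⊆ (good m α eq bs c bl en) =
      good (F⊆ m) α eq (All.map (λ (lt , b∈) → ≤-trans lt (n≤1+n w) , F⊆ b∈) bs) c bl en

    ascend : ∀ {F e} → (∀ {x} → x ∈ F → x ∈ V) → Good P T w F ((w , b) ∷ pre) e → Good P T (suc w) V pre e
    ascend F⊆ (good m α eq bs c bl en) =
      good (F⊆ m) (α ++ (w , b) ∷ []) (trans eq (sym (∷ʳ-++ α (w , b) pre)))
        (All.++⁺ (All.map (λ (lt , b∈) → ≤-trans lt (n≤1+n w) , F⊆ b∈) bs) ((≤-refl , here refl) ∷ [])) c bl en

    -- The separating step is `(w , b)`: its exponent is missing from the first path, and the deeper
    -- maxima of the second path are elements of `F`.
    cross : ∀ {F e e′} → All (λ q → proj₁ q ≢ w) (proj₂ e) → (∀ {x} → x ∈ F → x < proj₁ e) →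
      Good P T w F ((w , b) ∷ pre) e′ → Splits e e′
    cross w∉ F< (good _ α eq bs _ _ _) = α , (w , b) , pre , eq , w∉ , All.map (F< ∘ proj₂) bs

    w∉pre : All (λ q → proj₁ q ≢ w) pre
    w∉pre = All.map (λ lt eq → <-irrefl (sym eq) lt) coarse

    cases : _ → Entries (suc w) V pre
    cases (yes T≤near) = entries (list E₁ ++ list E₂)
      (All.++⁺ (All.map (widen near⊆) (goods E₁)) (All.map (ascend far⊆) (goods E₂)))
      (AllPairs.++⁺ (splits E₁) (splits E₂)
        (All.map (λ g₁ → All.map (cross (w∉ g₁) (λ x∈ → far<near x∈ (Good.mem g₁))) (goods E₂)) (goods E₁)))
      (begin
        length V                                      ≡⟨ sym near+far ⟩
        length near + length far                      ≤⟨ +-mono-≤ (covers E₁) (covers E₂) ⟩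
        (T + T) * length (list E₁) + (T + T) * length (list E₂)
                                                      ≡⟨ sym (*-distribˡ-+ (T + T) (length (list E₁)) _) ⟩
        (T + T) * (length (list E₁) + length (list E₂)) ≡⟨ cong ((T + T) *_) (sym (length-++ (list E₁))) ⟩
        (T + T) * length (list E₁ ++ list E₂)         ∎)
      where
      open ≤-Reasoning
      open Entries
      E₁ = build w near pre nearNode
      E₂ = build w far ((w , b) ∷ pre) (farNode (AllPairs.filter⁺ (∁? near?) sorted) (λ x∈ → x∈)
        (λ x∈ → block near (AllPairs.filter⁺ near? sorted) (inside ∘ near⊆) T≤near (far<near x∈) Within-near))
      w∉ : ∀ {e} → Good P T w near pre e → All (λ q → proj₁ q ≢ w) (proj₂ e)
      w∉ (good _ α refl bs _ _ _) = All.++⁺ (All.map (λ (lt , _) eq → <-irrefl eq lt) bs) w∉pre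
    -- The fewer than `T` near elements and the `T` elements cut off for the block are all charged
    -- to the one entry `(b , pre)`.
    cases (no near≱T) = entries ((b , pre) ∷ list E)
      (leaf nd ∷ All.map (ascend (far⊆ ∘ ∈-drop T far)) (goods E))
      (All.map (cross w∉pre (far<b ∘ ∈-drop T far)) (goods E) ∷ splits E)
      (begin
        length V                                      ≡⟨ sym near+far ⟩
        length near + length far                      ≤⟨ +-mono-≤ (<⇒≤ (≰⇒> near≱T)) (m≤n+m∸n (length far) T) ⟩
        T + (T + (length far ∸ T))                    ≡⟨ sym (+-assoc T T _) ⟩
        T + T + (length far ∸ T)                      ≡⟨ cong (T + T +_) (sym (length-drop T far)) ⟩
        T + T + length (drop T far)                   ≤⟨ +-monoʳ-≤ (T + T) (covers E) ⟩
        T + T + (T + T) * length (list E)             ≡⟨ sym (*-suc (T + T) _) ⟩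
        (T + T) * suc (length (list E))               ∎)
      where
      open ≤-Reasoning
      open Entries
      T<far : T < length far
      T<far = ≰⇒> λ far≤T → big (≤-trans (≤-reflexive (sym near+far)) (+-mono-≤ (<⇒≤ (≰⇒> near≱T)) far≤T))
      sFar = AllPairs.filter⁺ (∁? near?) sorted
      E = build w (drop T far) ((w , b) ∷ pre) (farNode (AllPairs.drop⁺ T sFar) (∈-drop T far)
        (λ x∈ → block (take T far) (AllPairs.take⁺ T sFar) (inside ∘ far⊆ ∘ ∈-take T far)
          (≤-reflexive (sym (trans (length-take T far) (m≤n⇒m⊓n≡m (<⇒≤ T<far)))))
          (λ y∈ → take>drop T sFar y∈ x∈)
          (λ y∈ z∈ → Within-far (∈-take T far y∈) (∈-take T far z∈))))

-- Entries whose paths share their first exponents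

pigeonhole : ∀ {A : Set} {R : A → A → Set} (f : A → ℕ) M t xs → AllPairs R xs →
  (∀ {x} → x ∈ xs → f x < M) → M * t < length xs →
  Σ (List A) λ ys → AllPairs R ys × (∀ {y} → y ∈ ys → y ∈ xs) ×
    (∀ {y z} → y ∈ ys → z ∈ ys → f y ≡ f z) × t < length ys
pigeonhole f zero    t (x ∷ xs) _ f< _ with () ← f< (here refl)
pigeonhole f (suc M) t xs prs f< many with t <? length (filter (λ x → f x ≟ M) xs)
... | yes t< = filter (λ x → f x ≟ M) xs , AllPairs.filter⁺ _ prs ,
  proj₁ ∘ ∈-filter⁻ _ {xs = xs} ,
  (λ y∈ z∈ → trans (proj₂ (∈-filter⁻ (λ x → f x ≟ M) {xs = xs} y∈))
                   (sym (proj₂ (∈-filter⁻ (λ x → f x ≟ M) {xs = xs} z∈)))) , t<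
... | no t≮ =
  let ys , prs′ , ys⊆ , same , t<ys = pigeonhole f M t rest (AllPairs.filter⁺ _ prs) f<M many′
  in  ys , prs′ , proj₁ ∘ ∈-filter⁻ _ {xs = xs} ∘ ys⊆ , same , t<ys
  where
  M? : Decidable (λ x → f x ≡ M)
  M? x = f x ≟ M
  rest = filter (∁? M?) xs
  f<M : ∀ {x} → x ∈ rest → f x < M
  f<M x∈ = let x∈xs , f≢ = ∈-filter⁻ (∁? M?) {xs = xs} x∈ in ≤∧≢⇒< (≤-pred (f< x∈xs)) f≢
  many′ : M * t < length rest
  many′ = +-cancelˡ-< t _ _ (<-≤-trans many (≤-trans (≤-reflexive (sym (length-filter-∁ M? xs)))
    (+-monoˡ-≤ (length rest) (≮⇒≥ t≮))))

-- The empty path is rejected at `suc m`, so that the predicate also guarantees `m` steps;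
-- `below⇒long` extracts this.
Below : ℕ → Path → ℕ → Set
Below zero    _             x = ⊤
Below (suc m) []            x = ⊥
Below (suc m) ((_ , b) ∷ p) x = b < x × Below m p x

below-++ : ∀ m α {β x} → All (λ q → proj₂ q < x) α → m ≤ length α → Below m (α ++ β) x
below-++ zero    α       _         _         = tt
below-++ (suc m) (q ∷ α) (b< ∷ α<) (s≤s m≤) = b< , below-++ m α α< m≤

below⇒long : ∀ m p {x} → Below m p x → m ≤ length p
below⇒long zero    p       _       = z≤n
below⇒long (suc m) (q ∷ p) (_ , b) = s≤s (below⇒long m p b)

top : ℕ → ℕ → Path → ℕ
top (suc m) x ((_ , b) ∷ p) = top m b p
top _       x _             = x

below-top : ∀ m p {x} {y} → Below (suc m) p y → top (suc m) x p < y
below-top zero    ((_ , b) ∷ p)     (b< , _) = b<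
below-top (suc m) ((_ , b) ∷ q ∷ p) (_ , bl) = below-top m (q ∷ p) {x = b} bl

module Keys (L : ℕ) where

  -- Past the end of the path the key is `L`. Genuine exponents are below `L`, so the default is
  -- distinguishable and a key takes `suc L` values.
  key : ℕ → Path → ℕ
  key _       []            = L
  key zero    ((w , _) ∷ p) = w
  key (suc i) (_ ∷ p)       = key i p

  key-++ : ∀ α {q β} → key (length α) (α ++ q ∷ β) ≡ proj₁ q
  key-++ []      = refl
  key-++ (_ ∷ α) = key-++ α

  key-∉ : ∀ {v} i p → All (λ r → proj₁ r ≢ v) p → v ≢ L → key i p ≢ v
  key-∉ i       []      _          v≢L eq = v≢L (sym eq)
  key-∉ zero    (_ ∷ p) (≢v ∷ _)   v≢L eq = ≢v eq
  key-∉ (suc i) (_ ∷ p) (_ ∷ rest) v≢L eq = key-∉ i p rest v≢L eq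

  key-≤ : ∀ i p → All (λ q → proj₁ q < L) p → key i p < suc L
  key-≤ i       []      _        = ≤-refl
  key-≤ zero    (_ ∷ p) (w< ∷ _) = m<n⇒m<1+n w<
  key-≤ (suc i) (_ ∷ p) (_ ∷ ws) = key-≤ i p ws

  -- The step at which the two paths separate is a key of the second path but not of
  -- the first, so paths with the same first m keys separate only after these.
  splits⇒below : ∀ m {e e′} → Splits e e′ → All (λ q → proj₁ q < L) (proj₂ e′) →
    (∀ i → i < m → key i (proj₂ e) ≡ key i (proj₂ e′)) → Below m (proj₂ e′) (proj₁ e)
  splits⇒below m {x , p} (α , q , β , refl , ∉p , α<) ws same with m ≤? length α
  ... | yes m≤ = below-++ m α α< m≤
  ... | no  m≰ = ⊥-elim (key-∉ (length α) p ∉p (λ eq → <-irrefl eq (All.head (All.++⁻ʳ α ws)))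
    (trans (same (length α) (≰⇒> m≰)) (key-++ α)))

  sameKeys : ∀ {R : Entry → Entry → Set} m t (es : List Entry) → AllPairs R es →
    (∀ {e} → e ∈ es → All (λ q → proj₁ q < L) (proj₂ e)) → suc L ^ m * t < length es →
    Σ (List Entry) λ fs → AllPairs R fs × (∀ {e} → e ∈ fs → e ∈ es) ×
      (∀ {e e′} → e ∈ fs → e′ ∈ fs → ∀ i → i < m → key i (proj₂ e) ≡ key i (proj₂ e′)) × t < length fs
  sameKeys zero    t es prs ws many = es , prs , (λ e∈ → e∈) , (λ _ _ _ ()) ,
    subst (_< length es) (+-identityʳ t) many
  sameKeys (suc m) t es prs ws many =
    let fs , prs′ , fs⊆ , eqm , many′ = pigeonhole (key m ∘ proj₂) (suc L) (suc L ^ m * t) es prs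
          (λ {e} e∈ → key-≤ m (proj₂ e) (ws e∈)) (subst (_< length es) (*-assoc (suc L) (suc L ^ m) t) many)
        gs , prs″ , gs⊆ , eqs , t< = sameKeys m t fs prs′ (ws ∘ fs⊆) many′
    in  gs , prs″ , fs⊆ ∘ gs⊆ ,
        (λ { {e} {e′} e∈ e′∈ i (s≤s i≤m) → helper (proj₂ e) (proj₂ e′) (eqm (gs⊆ e∈) (gs⊆ e′∈)) (eqs e∈ e′∈) i i≤m }) , t<
    where
    helper : ∀ p p′ → key m p ≡ key m p′ → (∀ i → i < m → key i p ≡ key i p′) →
      ∀ i → i ≤ m → key i p ≡ key i p′
    helper p p′ eqm eqs i i≤m with m≤n⇒m<n∨m≡n i≤m
    ... | inj₁ i<m  = eqs i i<m
    ... | inj₂ refl = eqm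

  ≤top : ∀ m x p → Chain x p → x ≤ top m x p
  ≤top zero    x p             _               = ≤-refl
  ≤top (suc m) x []            _               = ≤-refl
  ≤top (suc m) x ((w , b) ∷ p) (x≤ , _ , _ , c) = ≤-trans (m+n≤o⇒m≤o x x≤) (≤top m b p c)

  chain-top : ∀ m x p → Chain x p → m ≤ length p → ∀ i → i < m → x + 2 ^ key i p ≤ top m x p
  chain-top (suc m) x ((w , b) ∷ p) (x≤ , _ , _ , c) _ zero _ = ≤-trans x≤ (≤top m b p c)
  chain-top (suc m) x ((w , b) ∷ p) (x≤ , _ , _ , c) (s≤s long) (suc i) (s≤s i<m) =
    ≤-trans (+-monoˡ-≤ _ (m+n≤o⇒m≤o x x≤)) (chain-top m b p c long i i<m)

  _◃_ : ℕ → (ℕ → ℕ) → ℕ → ℕ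
  (x ◃ y) zero    = x
  (x ◃ y) (suc i) = y i

  module Layer {ss : List ℕ} {P : ℕ → Set} {y : ℕ → ℕ} (wy : Wave _<_ ss P y)
               (D : ℕ) (D> : ∀ j → j < sum ss → Δ y j < D) where

    First : ℕ → ℕ → Path → ℕ → Set
    First zero    x p ℓ = x + ℓ ≤ y 0
    First (suc m) x p ℓ = ℓ ≤ 2 ^ key 0 p

    -- The gaps run along `m` maxima of the path and then jump to `y 0`. The first gap is at least
    -- `ℓ ≥ D`, hence above every gap of `y`; the distance assumed from `top m x p` to `y 0` makes
    -- the final jump longer than each step before it.
    layer : ∀ m x p ℓ → P x → All (P ∘ proj₂) p → Chain x p → m ≤ length p →
      (∀ i → i < m → top m x p + 2 ^ suc (key i p) ≤ y 0) → First m x p ℓ → 1 ≤ ℓ → D ≤ ℓ →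
      Σ (ℕ → ℕ) λ z → Wave _<_ (suc m ∷ ss) P z × z 0 ≡ x × ℓ ≤ Δ z 0 ×
        (∀ j → j < sum ss → Δ z (suc m + j) < D)
    layer zero x p ℓ Px _ _ _ _ x+ℓ≤ 1≤ℓ D≤ℓ = x ◃ y , record { mem = mem′ ; inc = inc′ ; gapOrder = order } , refl , first , D>
      where
      first : ℓ ≤ y 0 ∸ x
      first = m+n≤o⇒m≤o∸n ℓ (subst (_≤ y 0) (+-comm x ℓ) x+ℓ≤)
      mem′ : ∀ i → i ≤ suc (sum ss) → P ((x ◃ y) i)
      mem′ zero    _        = Px
      mem′ (suc i) (s≤s i≤) = mem wy i i≤
      inc′ : Increasing (suc (sum ss)) (x ◃ y)
      inc′ zero    _        = ≤-trans (subst (_≤ x + ℓ) (+-comm x 1) (+-monoʳ-≤ x 1≤ℓ)) x+ℓ≤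
      inc′ (suc i) (s≤s i<) = inc wy i i<
      order : GapOrder _<_ (1 ∷ ss) (Δ (x ◃ y))
      order = (λ { _ (s≤s ()) }) , (λ j j< → <-≤-trans (D> j j<) (≤-trans D≤ℓ first)) , gapOrder wy
    layer (suc m) x ((w , b) ∷ p) ℓ Px (Pb ∷ Pp) (x+≤b , b<x+ , w<p , c) (s≤s long) far ℓ≤ 1≤ℓ D≤ℓ =
      -- The current gap is below 2^(w+1), so the next one must reach that length: its exponent is
      -- larger, or it is the jump to `y 0`.
      let z , wz , z0≡b , first , tail = layer m b p (2 ^ suc w) Pb Pp c long (λ i i<m → far (suc i) (s≤s i<m))
            (first′ m p far w<p long) (m^n>0 2 (suc w)) (≤-trans D≤ℓ (≤-trans ℓ≤ (^-monoʳ-≤ 2 (n≤1+n w))))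
      in  x ◃ z , record { mem = mem′ wz ; inc = inc′ wz z0≡b ; gapOrder = order wz z0≡b first tail } , refl , ℓ≤gap z0≡b , tail
      where
      first′ : ∀ m p → (∀ i → i < suc m → top (suc m) x ((w , b) ∷ p) + 2 ^ suc (key i ((w , b) ∷ p)) ≤ y 0) →
        All (λ q → w < proj₁ q) p → m ≤ length p → First m b p (2 ^ suc w)
      first′ zero    p             far _         _  = far 0 (s≤s z≤n)
      first′ (suc m) ((v , _) ∷ p) _   (w<v ∷ _) _  = ^-monoʳ-≤ 2 w<v
      ℓ≤gap : ∀ {z0} → z0 ≡ b → ℓ ≤ z0 ∸ x
      ℓ≤gap refl = ≤-trans ℓ≤ (m+n≤o⇒m≤o∸n (2 ^ w) (subst (_≤ b) (+-comm x (2 ^ w)) x+≤b))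
      gap< : ∀ {z0} → z0 ≡ b → z0 ∸ x < 2 ^ suc w
      gap< refl = m<n+o⇒m∸n<o b x {{m^n≢0 2 (suc w)}} b<x+
      mem′ : ∀ {z} → Wave _<_ (suc m ∷ ss) P z → ∀ i → i ≤ suc (suc m + sum ss) → P ((x ◃ z) i)
      mem′ wz zero    _        = Px
      mem′ wz (suc i) (s≤s i≤) = mem wz i i≤
      inc′ : ∀ {z} → Wave _<_ (suc m ∷ ss) P z → z 0 ≡ b → Increasing (suc (suc m + sum ss)) (x ◃ z)
      inc′ wz refl zero    _        = ≤-trans (subst (_≤ x + 2 ^ w) (+-comm x 1) (+-monoʳ-≤ x (m^n>0 2 w))) x+≤b
      inc′ wz z0≡b (suc i) (s≤s i<) = inc wz i i<
      order : ∀ {z} → Wave _<_ (suc m ∷ ss) P z → z 0 ≡ b → 2 ^ suc w ≤ Δ z 0 →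
        (∀ j → j < sum ss → Δ z (suc m + j) < D) → GapOrder _<_ (suc (suc m) ∷ ss) (Δ (x ◃ z))
      order {z} wz z0≡b first tail with gapOrder wz
      ... | asc , _ , rest = asc′ , (λ j j< → <-≤-trans (tail j j<) (≤-trans D≤ℓ (ℓ≤gap z0≡b))) , rest
        where
        lt : z 0 ∸ x < Δ z 0
        lt = <-≤-trans (gap< z0≡b) first
        asc′ : ∀ i → suc i < suc (suc m) → Δ (x ◃ z) i < Δ (x ◃ z) (suc i)
        asc′ zero    _         = lt
        asc′ (suc i) (s≤s i<) = asc i i<

  open Layer public using (layer)

-- Sizes that force a wave, layer by layer

Upper : List ℕ → (ℕ → ℕ) → Set
Upper ss B = ∀ L A → Sorted A → Within A (2 ^ L) → B L < length A →
  Σ (ℕ → ℕ) λ z → Wave _<_ ss (_∈ A) z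

wave-gap< : ∀ {ss B D y} → Wave _<_ ss (_∈ B) y → Within B D → ∀ j → j < sum ss → Δ y j < D
wave-gap< {y = y} wy wi j j< = m<n+o⇒m∸n<o (y (suc j)) (y j) {{>-nonZero D>0}} lt
  where
  lt = wi (mem wy j (<⇒≤ j<)) (mem wy (suc j) j<)
  D>0 = +-cancelˡ-< (y j) _ _ (≤-<-trans (≤-reflexive (+-identityʳ (y j))) (<-trans (inc wy j j<) lt))

wave-⊆ : ∀ {R ss x} {P Q : ℕ → Set} → (∀ {u} → P u → Q u) → Wave R ss P x → Wave R ss Q x
wave-⊆ P⊆Q (wave m i g) = wave (λ j j≤ → P⊆Q (m j j≤)) i g

-- Two separate stretches of length `k` between `a` and `y` supply the distance 2k that `layer`
-- requires, with `k` a power 2^(key i).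
doubled : ∀ {a b c d e y} k → a < b → b + k ≤ c → c < d → d + k ≤ e → e < y → a + (k + (k + 0)) ≤ y
doubled {a} {b} {c} {d} {e} {y} k a<b b+k≤c c<d d+k≤e e<y =
  ≤-trans (≤-reflexive (trans (cong (λ u → a + (k + u)) (+-identityʳ k)) (sym (+-assoc a k k))))
    (≤-trans (+-monoˡ-≤ k (≤-trans (+-monoˡ-≤ k (<⇒≤ a<b)) b+k≤c))
      (≤-trans (+-monoˡ-≤ k (<⇒≤ c<d)) (≤-trans d+k≤e (<⇒≤ e<y))))

-- The size multiplies three losses: 2T elements per entry with T = `suc (B L)`, `suc L` values for
-- each of `suc m` keys, and 3 because four entries are taken from one class.
upper-big : ∀ {ss B} m → Upper ss B →
  Upper (suc (suc m) ∷ ss) (λ L → (suc (B L) + suc (B L)) * (suc L ^ suc m * 3))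
upper-big {ss} {B} m up L A sA wA many = finish fs fs-splits fs⊆ fs-same four
  where
  open Keys L
  open Tree (_∈ A) (suc (B L)) (s≤s z≤n)
  E : Entries L A []
  E = build L A [] (record { sorted = sA ; inside = λ x∈ → x∈ ; within = wA
    ; chain = λ _ → tt ; blocked = λ _ → tt ; ends = [] ; coarse = [] })
  es = Entries.list E
  Good′ = Good (_∈ A) (suc (B L)) L A []
  keys< : ∀ {e} → Good′ e → All (λ q → proj₁ q < L) (proj₂ e)
  keys< (good _ _ refl bs _ _ _) = All.++⁺ (All.map proj₁ bs) []
  classes = sameKeys (suc m) 3 es (Entries.splits E) (keys< ∘ All.lookup (Entries.goods E))
    (*-cancelˡ-< (suc (B L) + suc (B L)) _ _ (<-≤-trans many (Entries.covers E)))
  fs = proj₁ classes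
  fs-splits = proj₁ (proj₂ classes)
  fs⊆ : ∀ {e} → e ∈ fs → Good′ e
  fs⊆ = All.lookup (Entries.goods E) ∘ proj₁ (proj₂ (proj₂ classes))
  fs-same = proj₁ (proj₂ (proj₂ (proj₂ classes)))
  four = proj₂ (proj₂ (proj₂ (proj₂ classes)))
  finish : ∀ fs → AllPairs Splits fs → (∀ {e} → e ∈ fs → Good′ e) →
    (∀ {e e′} → e ∈ fs → e′ ∈ fs → ∀ i → i < suc m → key i (proj₂ e) ≡ key i (proj₂ e′)) →
    3 < length fs → Σ (ℕ → ℕ) λ z → Wave _<_ (suc (suc m) ∷ ss) (_∈ A) z
  finish (_ ∷ []) _ _ _ (s≤s ())
  finish (_ ∷ _ ∷ []) _ _ _ (s≤s (s≤s ()))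
  finish (_ ∷ _ ∷ _ ∷ []) _ _ _ (s≤s (s≤s (s≤s ())))
  finish ((x₄ , p₄) ∷ (x₃ , p₃) ∷ (x₂ , p₂) ∷ (x₁ , p₁) ∷ _)
         ((s₄₃ ∷ _) ∷ (s₃₂ ∷ _) ∷ (s₂₁ ∷ _) ∷ _) gd same _ =
    -- The diameter bound of the block is relaxed to 2^L, so that the threshold `B L` chosen in
    -- advance applies whatever its exponent is.
    let y , wy = up L elems sorted
          (λ u∈ v∈ → <-≤-trans (within u∈ v∈) (+-monoʳ-≤ _ (^-monoʳ-≤ 2 (<⇒≤ k<L)))) large
        z , wz , _ = layer (wave-⊆ inside wy) (2 ^ key 0 p₁) (wave-gap< wy within) (suc m) x₁ p₁ (2 ^ key 0 p₁)
          (Good.mem (gd e₁)) (Good.ends (gd e₁)) (Good.chain (gd e₁)) (below⇒long (suc m) p₁ b₁)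
          (far (above (mem wy 0 z≤n))) ≤-refl (m^n>0 2 (key 0 p₁)) ≤-refl
    in  z , wz
    where
    e₄ = here refl
    e₃ = there (here refl)
    e₂ = there (there (here refl))
    e₁ = there (there (there (here refl)))
    b₁ : Below (suc m) p₁ x₂
    b₁ = splits⇒below (suc m) {e′ = x₁ , p₁} s₂₁ (keys< (gd e₁)) (same e₂ e₁)
    b₂ : Below (suc m) p₂ x₃
    b₂ = splits⇒below (suc m) {e′ = x₂ , p₂} s₃₂ (keys< (gd e₂)) (same e₃ e₂)
    b₃ : Below (suc m) p₃ x₄
    b₃ = splits⇒below (suc m) {e′ = x₃ , p₃} s₄₃ (keys< (gd e₃)) (same e₄ e₃)
    step : ∀ {x p} → Good′ (x , p) → suc m ≤ length p →
      (∀ i → i < suc m → key i p ≡ key i p₁) → ∀ i → i < suc m → x + 2 ^ key i p₁ ≤ top (suc m) x p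
    step {x} {p} g long eq i i≤ = subst (λ k → x + 2 ^ k ≤ top (suc m) x p) (eq i i≤)
      (chain-top (suc m) x p (Good.chain g) long i i≤)
    -- Between the top of `p₁` and `x₄` lie the paths of `x₂` and `x₃`, each of length at least
    -- 2^(key i p₁) because the keys agree.
    far : ∀ {v} → x₄ < v → ∀ i → i < suc m → top (suc m) x₁ p₁ + 2 ^ suc (key i p₁) ≤ v
    far x₄< i i≤ = doubled (2 ^ key i p₁) (below-top m p₁ b₁)
      (step (gd e₂) (below⇒long (suc m) p₂ b₂) (same e₂ e₁) i i≤) (below-top m p₂ b₂)
      (step (gd e₃) (below⇒long (suc m) p₃ b₃) (same e₃ e₁) i i≤) (<-trans (below-top m p₃ b₃) x₄<)
    k<L : key 0 p₁ < L
    k<L = nonempty p₁ (below⇒long (suc m) p₁ b₁) (keys< (gd e₁))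
      where
      nonempty : ∀ p → suc m ≤ length p → All (λ q → proj₁ q < L) p → key 0 p < L
      nonempty (_ ∷ _) _ (w< ∷ _) = w<
    blk : Block (_∈ A) (suc (B L)) (key 0 p₁) x₄
    blk = get p₄ (same e₄ e₁ 0 (s≤s z≤n)) (Good.blocked (gd e₄))
      where
      get : ∀ p → key 0 p ≡ key 0 p₁ → Blocked (_∈ A) (suc (B L)) x₄ p →
        Block (_∈ A) (suc (B L)) (key 0 p₁) x₄
      get []      eq _  = ⊥-elim (<-irrefl (sym eq) k<L)
      get (_ ∷ _) eq bl = subst (λ w → Block (_∈ A) (suc (B L)) w x₄) eq bl
    open Block blk

splitMin : ∀ x V → Sorted (x ∷ V) → Σ ℕ λ a → Σ (List ℕ) λ W →
  Sorted W × (∀ {y} → y ∈ W → a < y × y ∈ x ∷ V) × a ∈ x ∷ V × length W ≡ length V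
splitMin x []      s = x , [] , [] , (λ ()) , here refl , refl
splitMin x (y ∷ V) (x> ∷ s) =
  let a , W , sW , W⊆ , a∈ , len = splitMin y V s
  in  a , x ∷ W , All.tabulate (λ z∈ → All.lookup x> (proj₂ (W⊆ z∈))) ∷ sW ,
      (λ { (here refl) → All.lookup x> a∈ , here refl
         ; (there z∈)  → proj₁ (W⊆ z∈) , there (proj₂ (W⊆ z∈)) }) ,
      there a∈ , cong suc len

-- Either the outermost annulus holds more than `t` points, or at most `t` are discarded and the
-- search goes on inside. The points found are less than 2^w apart but at least 2^w from `a`, so a
-- gap starting at `a` dominates the gaps among them.
annulus : ∀ L t a V → Sorted V → (∀ {y} → y ∈ V → a < y × y < a + 2 ^ L) → L * t < length V →
  Σ ℕ λ w → Σ (List ℕ) λ B → w ≤ L × Sorted B × (∀ {y} → y ∈ B → y ∈ V × a + 2 ^ w ≤ y) ×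
    Within B (2 ^ w) × t < length B
annulus zero    t a (x ∷ V) _ V⊆ _ =
  let a<x , x<a+1 = V⊆ (here refl)
  in  ⊥-elim (<-irrefl refl (<-≤-trans x<a+1 (subst (_≤ x) (+-comm 1 a) a<x)))
annulus (suc L) t a V sV V⊆ many with t <? length (filter (λ y → a + 2 ^ L ≤? y) V)
... | yes t< = L , filter far? V , n≤1+n L , AllPairs.filter⁺ far? sV , ∈-filter⁻ far? {xs = V} ,
  (λ y∈ z∈ → far-close (proj₂ (V⊆ (proj₁ (∈-filter⁻ far? {xs = V} z∈)))) (proj₂ (∈-filter⁻ far? {xs = V} y∈))) , t<
  where
  far? : Decidable (λ y → a + 2 ^ L ≤ y)
  far? y = a + 2 ^ L ≤? y
  far-close : ∀ {y z} → z < a + 2 ^ suc L → a + 2 ^ L ≤ y → z < y + 2 ^ L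
  far-close z< ≤y = <-≤-trans z< (≤-trans (≤-reflexive (trans (cong (a +_) (2^suc L)) (sym (+-assoc a _ _))))
    (+-monoˡ-≤ (2 ^ L) ≤y))
... | no t≮ =
  let w , B , w≤ , sB , B⊆ , wi , t< = annulus L t a (filter (∁? far?) V) (AllPairs.filter⁺ (∁? far?) sV)
        (λ y∈ → let y∈V , ¬far = ∈-filter⁻ (∁? far?) {xs = V} y∈ in proj₁ (V⊆ y∈V) , ≰⇒> ¬far)
        (+-cancelˡ-< t _ _ (<-≤-trans many (≤-trans (≤-reflexive (sym (length-filter-∁ far? V)))
          (+-monoˡ-≤ _ (≮⇒≥ t≮)))))
  in  w , B , m≤n⇒m≤1+n w≤ , sB ,
      (λ y∈ → proj₁ (∈-filter⁻ (∁? far?) {xs = V} (proj₁ (B⊆ y∈))) , proj₂ (B⊆ y∈)) , wi , t<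
  where
  far? : Decidable (λ y → a + 2 ^ L ≤ y)
  far? y = a + 2 ^ L ≤? y

-- `suc` pays for the minimum `a`. With the empty path, `layer` adds the single gap from `a` to the
-- wave found in an annulus.
upper-one : ∀ {ss B} → Upper ss B → Upper (1 ∷ ss) (λ L → suc (L * B L))
upper-one {ss} {B} up L (x ∷ V) sA wA (s≤s many) =
  let a , W , sW , W⊆ , a∈ , len = splitMin x V sA
      w , C , w≤L , sC , C⊆ , wi , large = annulus L (B L) a W sW
        (λ y∈ → proj₁ (W⊆ y∈) , wA a∈ (proj₂ (W⊆ y∈))) (subst (L * B L <_) (sym len) many)
      y , wy = up L C sC (λ u∈ v∈ → <-≤-trans (wi u∈ v∈) (+-monoʳ-≤ _ (^-monoʳ-≤ 2 w≤L))) large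
      z , wz , _ = layer (wave-⊆ (proj₂ ∘ W⊆ ∘ proj₁ ∘ C⊆) wy) (2 ^ w) (wave-gap< wy wi) 0 a [] (2 ^ w)
        a∈ [] tt z≤n (λ _ ()) (proj₂ (C⊆ (mem wy 0 z≤n))) (m^n>0 2 w) ≤-refl
  in  z , wz
  where open Keys L

-- Lower bound: families avoiding weak waves

-- A set is given by an injective enumeration because `TranslateColoring` matches indices with
-- residues.
record Family : Set where
  field
    size      : ℕ
    span      : ℕ
    el        : Fin size → ℕ
    bounded   : ∀ i → el i < span
    injective : ∀ {i j} → el i ≡ el j → i ≡ j
open Family

_∈ᶠ_ : ℕ → Family → Set
v ∈ᶠ F = Σ (Fin (size F)) λ i → el F i ≡ v

∈ᶠ-bounded : ∀ {v} F → v ∈ᶠ F → v < span F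
∈ᶠ-bounded F (i , refl) = bounded F i

Avoids : Family → List ℕ → Set
Avoids F ss = ∀ x → ¬ Wave _≤_ ss (_∈ᶠ F) x

-- Separation is allowed in either direction, as the offsets grow in `Depart` and shrink in
-- `Approach`.
module Copies (F : Family) (L : ℕ) (off : ℕ → ℕ) (N : ℕ)
              (off-separated : ∀ {p q} → p < q → q < L → off p + span F ≤ off q ⊎ off q + span F ≤ off p)
              (off-bounded : ∀ {p} → p < L → off p + span F ≤ N) where

  InCopy : ℕ → ℕ → Set
  InCopy q v = q < L × Σ ℕ λ u → u ∈ᶠ F × v ≡ off q + u

  disjoint : ∀ {p q u v} → off p + span F ≤ off q → u < span F → off p + u ≢ off q + v
  disjoint {p} {q} {u} {v} sep u< eq = <-irrefl eq
    (<-≤-trans (+-monoʳ-< (off p) u<) (≤-trans sep (m≤m+n (off q) v)))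

  copy-unique : ∀ {p q u v} → p < L → q < L → u < span F → v < span F →
    off p + u ≡ off q + v → p ≡ q
  copy-unique {p} {q} p<L q<L u< v< eq with <-cmp p q
  ... | tri≈ _ p≡q _ = p≡q
  ... | tri< p<q _ _ with off-separated p<q q<L
  ...   | inj₁ sep = ⊥-elim (disjoint sep u< eq)
  ...   | inj₂ sep = ⊥-elim (disjoint sep v< (sym eq))
  copy-unique p<L q<L u< v< eq | tri> _ _ q<p with off-separated q<p p<L
  ...   | inj₁ sep = ⊥-elim (disjoint sep v< (sym eq))
  ...   | inj₂ sep = ⊥-elim (disjoint sep u< eq)

  place : Fin L × Fin (size F) → ℕ
  place (q , j) = off (toℕ q) + el F j

  place-injective : ∀ {a b} → place a ≡ place b → a ≡ b
  place-injective {p , i} {q , j} eq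
    with refl ← toℕ-injective {i = p} {q} (copy-unique (toℕ<n p) (toℕ<n q) (bounded F i) (bounded F j) eq)
    with refl ← injective F (+-cancelˡ-≡ (off (toℕ p)) _ _ eq) = refl

  copies : Family
  copies = record
    { size = L * size F
    ; span = N
    ; el = place ∘ remQuot (size F)
    ; bounded = λ i → let q , j = remQuot {L} (size F) i in
        <-≤-trans (+-monoʳ-< (off (toℕ q)) (bounded F j)) (off-bounded (toℕ<n q))
    ; injective = λ {i} {j} eq → trans (sym (combine-remQuot {L} (size F) i))
        (trans (cong (λ (q , j) → combine q j) (place-injective eq)) (combine-remQuot {L} (size F) j)) }

  inCopy : ∀ {v} → v ∈ᶠ copies → Σ ℕ λ q → InCopy q v
  inCopy (i , refl) = let q , j = remQuot {L} (size F) i in toℕ q , toℕ<n q , el F j , (j , refl) , refl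

  coherent : ∀ k (y : ℕ → ℕ) → (∀ i → i ≤ k → y i ∈ᶠ copies) →
    (∀ i → i < k → ∀ {p q} → InCopy p (y i) → InCopy q (y (suc i)) → p ≡ q) →
    Σ ℕ λ q → ∀ i → i ≤ k → InCopy q (y i)
  coherent k y y∈ same with inCopy (y∈ 0 z≤n)
  ... | q , y0 = q , stays
    where
    stays : ∀ i → i ≤ k → InCopy q (y i)
    stays zero    _   = y0
    stays (suc i) i<k with inCopy (y∈ (suc i) i<k)
    ... | p , yi = subst (λ p → InCopy p (y (suc i))) (sym (same i i<k (stays i (<⇒≤ i<k)) yi)) yi

  translate : ∀ {R : ℕ → ℕ → Set} {ss} {y : ℕ → ℕ} q → (∀ i → i ≤ sum ss → InCopy q (y i)) → Increasing (sum ss) y →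
    GapOrder R ss (Δ y) → Wave R ss (_∈ᶠ F) (λ i → y i ∸ off q) ×
    (∀ i → i < sum ss → Δ y i ≡ Δ (λ i → y i ∸ off q) i)
  translate {R} {ss} {y} q y∈ inc< order = wave mem′ inc′ (GapOrder-cong ss Δ≡ order) , Δ≡
    where
    mem′ : ∀ i → i ≤ sum ss → (y i ∸ off q) ∈ᶠ F
    mem′ i i≤ with y∈ i i≤
    ... | _ , u , u∈ , eq = subst (_∈ᶠ F) (sym (trans (cong (_∸ off q) eq) (m+n∸m≡n (off q) u))) u∈
    inc′ : Increasing (sum ss) (λ i → y i ∸ off q)
    inc′ i i< with y∈ i (<⇒≤ i<)
    ... | _ , u , _ , eq = ∸-monoˡ-< (inc< i i<) (subst (off q ≤_) (sym eq) (m≤m+n (off q) u))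
    Δ≡ : ∀ i → i < sum ss → Δ y i ≡ Δ (λ i → y i ∸ off q) i
    Δ≡ i i< with y∈ i (<⇒≤ i<) | y∈ (suc i) i<
    ... | _ , u , _ , eq | _ , v , _ , eq′ rewrite eq | eq′ | m+n∸m≡n (off q) u | m+n∸m≡n (off q) v =
      [m+n]∸[m+o]≡n∸o (off q) v u

4^-step : ∀ r {p q} → p < q → 4 * (r * 4 ^ p) ≤ r * 4 ^ q
4^-step r {p} {q} p<q = ≤-trans (≤-reflexive (eq r (4 ^ p))) (*-monoʳ-≤ r (^-monoʳ-≤ 4 p<q))
  where
  eq : ∀ r e → 4 * (r * e) ≡ r * (4 * e)
  eq = solve-∀

≤4^ : ∀ r p → r ≤ r * 4 ^ p
≤4^ r p = m≤m*n r (4 ^ p) {{m^n≢0 4 p}}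

double-≤ : ∀ {r e e′} → r ≤ e → 4 * e ≤ e′ → e + r ≤ e′
double-≤ {r} {e} {e′} r≤e 4e≤e′ = lin-≤ (e + e) (+-mono-≤ r≤e 4e≤e′) (eq r e e′)
  where
  eq : ∀ r e e′ → e + r + (e + e′) + (e + e) ≡ e′ + (r + 4 * e)
  eq = solve-∀

module Depart (F : Family) (L : ℕ) where

  private R = span F

  off : ℕ → ℕ
  off q = R * 4 ^ q

  open Copies F L off (R * 4 ^ L)
    (λ {p} p<q _ → inj₁ (double-≤ (≤4^ R p) (4^-step R p<q)))
    (λ {p} p<L → double-≤ (≤4^ R p) (4^-step R p<L)) public

  -- As `u < R ≤ off p`, twice `v` is below `4 * off p`, which the base 4 keeps at most `off q`.
  jump : ∀ {p q v v′} → InCopy p v → InCopy q v′ → v < v′ → p ≢ q → v + v < v′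
  jump {p} {q} (_ , u , u∈ , refl) (_ , u′ , u′∈ , refl) v<v′ p≢q with <-cmp p q
  ... | tri≈ _ p≡q _ = ⊥-elim (p≢q p≡q)
  ... | tri> _ _ q<p = ⊥-elim (<-asym v<v′ (<-≤-trans (+-monoʳ-< (off q) (∈ᶠ-bounded F u′∈))
    (≤-trans (double-≤ (≤4^ R q) (4^-step R q<p)) (m≤m+n (off p) u))))
  ... | tri< p<q _ _ = lin-≤ (u′ + 1) (+-mono-≤ (+-mono-≤ u<e u<e) (4^-step R p<q))
          (eq (off p) (off q) u u′)
    where
    u<e : suc u ≤ off p
    u<e = <-≤-trans (∈ᶠ-bounded F u∈) (≤4^ R p)
    eq : ∀ e e′ u u′ → suc (e + u + (e + u)) + (e + e + e′) + (u′ + 1) ≡ e′ + u′ + (suc u + suc u + 4 * e)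
    eq = solve-∀

  -- After the first gap no step changes copies: such a step from `y i` would be longer than `y i`,
  -- hence than `y 0`, whereas the order bounds it by the first gap, which is at most `y 0`. The
  -- remaining layers thus form a weak wave in a translate of `F`.
  depart-avoids : ∀ {ss} → Avoids F ss → Avoids copies (1 ∷ ss)
  depart-avoids {ss} av x (wave mem′ inc′ (_ , low , rest)) =
    av _ (proj₁ (translate (proj₁ one) (proj₂ one) (λ i i< → inc′ (suc i) (s≤s i<)) rest))
    where
    y = x ∘ suc
    y₀≤ : ∀ i → i ≤ sum ss → y 0 ≤ y i
    y₀≤ = increasing-mono {x = y} (λ i i< → inc′ (suc i) (s≤s i<))
    one = coherent (sum ss) y (λ i i≤ → mem′ (suc i) (s≤s i≤)) λ i i< {p} {q} yi yi′ → same i i< yi yi′ (p ≟ q)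
      where
      same : ∀ i → i < sum ss → ∀ {p q} → InCopy p (y i) → InCopy q (y (suc i)) → _ → p ≡ q
      same i i< yi yi′ (yes p≡q) = p≡q
      same i i< yi yi′ (no p≢q)  = ⊥-elim (<-irrefl refl
        (<-≤-trans (m+n≤o⇒m≤o∸n (suc (y i)) (jump yi yi′ (inc′ (suc i) (s≤s i<)) p≢q))
          (≤-trans (low i i<) (≤-trans (m∸n≤m (y 0) (x 0)) (y₀≤ i (<⇒≤ i<))))))

-- Copy `p` starts at distance `R * 4 ^ p` before the limit `N`, so moving right lowers the index.
module Approach (F : Family) (L : ℕ) where

  private
    R = span F
    N = R * 4 ^ L

  off : ℕ → ℕ
  off p = N ∸ R * 4 ^ p

  off+ : ∀ {p} → p < L → off p + R * 4 ^ p ≡ N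
  off+ p<L = m∸n+n≡m (*-monoʳ-≤ R (^-monoʳ-≤ 4 (<⇒≤ p<L)))

  off-desc : ∀ {p q} → p < q → q < L → off q + R ≤ off p
  off-desc {p} {q} p<q q<L = lin-≤ 0
    (+-mono-≤ (double-≤ (≤4^ R p) (4^-step R p<q)) (≤-reflexive (trans (off+ q<L) (sym (off+ (<-trans p<q q<L))))))
    (eq (off q) R (off p) (R * 4 ^ p) (R * 4 ^ q))
    where
    eq : ∀ a r b e e′ → a + r + (e′ + (b + e)) + 0 ≡ b + (e + r + (a + e′))
    eq = solve-∀

  open Copies F L off N (λ p<q q<L → inj₂ (off-desc p<q q<L))
    (λ {p} p<L → ≤-trans (+-monoʳ-≤ (off p) (≤4^ R p)) (≤-reflexive (off+ p<L))) public

  member : ∀ {p v} → InCopy p v → Σ ℕ λ u → u < R × v + R * 4 ^ p ≡ N + u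
  member {p} (p<L , u , u∈ , refl) = u , ∈ᶠ-bounded F u∈ ,
    trans (eq (off p) u (R * 4 ^ p)) (cong (_+ u) (off+ p<L))
    where
    eq : ∀ a u e → a + u + e ≡ a + e + u
    eq = solve-∀

  crossing-desc : ∀ {p q v v′} → InCopy p v → InCopy q v′ → v < v′ → p ≢ q → q < p
  crossing-desc {p} {q} (_ , u , u∈ , refl) (q<L , u′ , u′∈ , refl) v<v′ p≢q with <-cmp p q
  ... | tri> _ _ q<p = q<p
  ... | tri≈ _ p≡q _ = ⊥-elim (p≢q p≡q)
  ... | tri< p<q _ _ = ⊥-elim (<-asym v<v′ (<-≤-trans (+-monoʳ-< (off q) (∈ᶠ-bounded F u′∈))
    (≤-trans (off-desc p<q q<L) (m≤m+n (off p) u))))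

  -- A step into a nearer copy exceeds the distance left to the limit N.
  crossing-overshoots : ∀ {p q v v′} → InCopy p v → InCopy q v′ → v < v′ → p ≢ q →
    N + v < v′ + v′
  crossing-overshoots {p} {q} {v} {v′} vp vq v<v′ p≢q =
    let u  , u<  , e  = member vp
        u′ , u′< , e′ = member vq
    in  lin-≤ (R * 4 ^ q + (u′ + u′)) (+-mono-≤ (+-mono-≤ u< (≤4^ R q)) (+-mono-≤ (4^-step R (crossing-desc vp vq v<v′ p≢q))
          (+-mono-≤ (≤-reflexive e) (+-mono-≤ (≤-reflexive (sym e′)) (≤-reflexive (sym e′))))))
          (eq N v v′ u u′ R (R * 4 ^ p) (R * 4 ^ q))
    where
    eq : ∀ N v v′ u u′ r e e′ →
      suc (N + v) + (r + e′ + (e + (N + u + (v′ + e′ + (v′ + e′))))) + (e′ + (u′ + u′)) ≡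
      v′ + v′ + (suc u + r + (4 * e′ + (v + e + (N + u′ + (N + u′)))))
    eq = solve-∀

  -- The starting points of two copies differ by at least 3R, and positions inside a copy make up
  -- for less than `R`. Gaps below `R` therefore stay in one copy.
  crossing-far : ∀ {p q v v′} → InCopy p v → InCopy q v′ → v < v′ → p ≢ q → v + R ≤ v′
  crossing-far {p} {q} {v} {v′} vp@(p<L , u , u∈ , refl) vq@(q<L , u′ , _ , refl) v<v′ p≢q =
    lin-≤ (R * 4 ^ q + u′ + 1) (+-mono-≤ (+-mono-≤ (∈ᶠ-bounded F u∈) (≤4^ R q)) (+-mono-≤ (≤4^ R q) (+-mono-≤ (4^-step R q<p)
      (≤-reflexive (trans (off+ p<L) (sym (off+ q<L)))))))
      (eq (off p) (off q) u u′ R (R * 4 ^ p) (R * 4 ^ q))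
    where
    q<p = crossing-desc vp vq v<v′ p≢q
    eq : ∀ a b u u′ r e e′ →
      a + u + r + (r + e′ + (e′ + (e + (b + e′)))) + (e′ + u′ + 1) ≡
      b + u′ + (suc u + r + (r + (4 * e′ + (a + e))))
    eq = solve-∀

approaches : ℕ → Family → ℕ → Family
approaches zero    F L = F
approaches (suc t) F L = Approach.copies (approaches t F L) L

span-approaches : ∀ t F L → span F ≤ span (approaches t F L)
span-approaches zero    F L = ≤-refl
span-approaches (suc t) F L = ≤-trans (span-approaches t F L) (≤4^ _ L)

-- Induction on `t`: only the last gap of the run can change copies, since a gap following a change
-- is at least as long and would lead past `N`. Without its last gap the run lies in one copy of the
-- previous level; for `t = 0` a single gap inside `F` remains.
approaches-ascending : ∀ t F L x → Wave _≤_ (suc t ∷ []) (_∈ᶠ approaches t F L) x → Δ x 0 < span F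
approaches-ascending zero F L x (wave mem′ _ _) =
  ≤-<-trans (m∸n≤m (x 1) (x 0)) (∈ᶠ-bounded F (mem′ 1 ≤-refl))
approaches-ascending (suc t) F L x (wave mem′ inc′ (asc , _ , _)) =
  let w , Δ≡ = translate {ss = suc t ∷ []} (proj₁ one) (proj₂ one) (λ i i< → inc′ i (m<n⇒m<1+n i<))
                 ((λ i i< → asc i (m<n⇒m<1+n i<)) , (λ _ ()) , tt)
  in  subst (_< span F) (sym (Δ≡ 0 (s≤s z≤n))) (approaches-ascending t F L _ w)
  where
  open Approach (approaches t F L) L
  inc₁ : Increasing (suc t + 0) x
  inc₁ i i< = inc′ i (m<n⇒m<1+n i<)
  same : ∀ i → i < suc t + 0 → ∀ {p q} → InCopy p (x i) → InCopy q (x (suc i)) → p ≡ q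
  same i i< {p} {q} xi xi′ with p ≟ q
  ... | yes p≡q = p≡q
  ... | no  p≢q = ⊥-elim (<-irrefl refl (<-≤-trans beyond over))
    where
    i<t : i < suc t
    i<t = subst (i <_) (+-identityʳ (suc t)) i<
    d = x (suc i) ∸ x i
    x+d : x i + d ≡ x (suc i)
    x+d = m+[n∸m]≡n (<⇒≤ (inc₁ i i<))
    over : x (suc i) + x (suc i) ≤ x (suc (suc i)) + x i
    over = ≤-trans (≤-reflexive (trans (cong (x (suc i) +_) (sym x+d)) (eq (x (suc i)) (x i) d)))
      (+-monoˡ-≤ (x i) (≤-trans (+-monoʳ-≤ (x (suc i)) (asc i (s≤s i<t)))
        (≤-reflexive (m+[n∸m]≡n (<⇒≤ (inc′ (suc i) (s≤s i<)))))))
      where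
      eq : ∀ a b d → a + (b + d) ≡ a + d + b
      eq = solve-∀
    beyond : x (suc (suc i)) + x i < x (suc i) + x (suc i)
    beyond = <-trans (+-monoˡ-< (x i) (∈ᶠ-bounded copies (mem′ (suc (suc i)) (s≤s i<))))
      (crossing-overshoots xi xi′ (inc₁ i i<) p≢q)
  one = coherent (suc t + 0) x (λ i i≤ → mem′ i (m≤n⇒m≤1+n i≤)) same

-- Changing copies at any level costs at least the span of the level below, hence at least `span F`;
-- shorter gaps confine the wave to one innermost copy of `F`.
approaches-local : ∀ t F L {ss} → Avoids F ss → ∀ y → (∀ i → i < sum ss → Δ y i < span F) →
  ¬ Wave _≤_ ss (_∈ᶠ approaches t F L) y
approaches-local zero    F L av y _ w = av y w
approaches-local (suc t) F L {ss} av y small w =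
  let w′ , Δ≡ = translate {ss = ss} {y} (proj₁ one) (proj₂ one) (inc w) (gapOrder w)
  in  approaches-local t F L av _ (λ i i< → subst (_< span F) (Δ≡ i i<) (small i i<)) w′
  where
  open Approach (approaches t F L) L
  same : ∀ i → i < sum ss → ∀ {p q} → InCopy p (y i) → InCopy q (y (suc i)) → p ≡ q
  same i i< {p} {q} yi yi′ with p ≟ q
  ... | yes p≡q = p≡q
  ... | no  p≢q = ⊥-elim (<-irrefl refl (<-≤-trans (small i i<) (≤-trans (span-approaches t F L)
    (m+n≤o⇒m≤o∸n _ (subst (_≤ y (suc i)) (+-comm (y i) _) (crossing-far yi yi′ (inc w i i<) p≢q))))))
  one = coherent (sum ss) y (mem w) same

first-layer : ∀ {R P x} s ss → Wave R (s ∷ ss) P x → Wave R (s ∷ []) P x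
first-layer s ss (wave mem′ inc′ (asc , _ , _)) = wave
  (λ i i≤ → mem′ i (≤-trans i≤ s≤)) (λ i i< → inc′ i (<-≤-trans i< s≤)) (asc , (λ _ ()) , tt)
  where
  s≤ : s + 0 ≤ s + sum ss
  s≤ = +-monoʳ-≤ s z≤n

later-layers : ∀ {R P} {x : ℕ → ℕ} s ss → Wave R (s ∷ ss) P x → Wave R ss P (λ i → x (s + i))
later-layers {R} {x = x} s ss (wave mem′ inc′ (_ , _ , rest)) = wave
  (λ i i≤ → mem′ (s + i) (+-monoʳ-≤ s i≤))
  (λ i i< → subst (λ a → x (s + i) < x a) (sym (+-suc s i)) (inc′ (s + i) (+-monoʳ-< s i<)))
  (GapOrder-cong ss (λ i _ → cong (λ a → x a ∸ x (s + i)) (sym (+-suc s i))) rest)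

-- The first gap of the ascending run is below `span F` and bounds all gaps of the later layers,
-- which therefore fall into one copy of `F`.
approaches-avoids : ∀ t F L {ss} → Avoids F ss → Avoids (approaches t F L) (suc t ∷ ss)
approaches-avoids t F L {ss} av x w@(wave _ _ (_ , low , _)) =
  approaches-local t F L {ss} av (λ i → x (suc t + i))
    (λ i i< → subst (λ a → x a ∸ x (suc t + i) < span F) (sym (+-suc (suc t) i))
      (≤-<-trans (low i i<) (approaches-ascending t F L x (first-layer (suc t) ss w))))
    (later-layers (suc t) ss w)

-- Families for arbitrary layer sizes

point : Family
point = record { size = 1 ; span = 1 ; el = λ _ → 0 ; bounded = λ _ → s≤s z≤n
               ; injective = λ { {Fin.zero} {Fin.zero} _ → refl } }

-- A span of 1 would force the first gap to vanish, so `t` iterations suffice for a final layer of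
-- size `suc t`.
approaches-point-avoids : ∀ t L → Avoids (approaches t point L) (suc t ∷ [])
approaches-point-avoids t L x w = <-irrefl refl
  (<-≤-trans (approaches-ascending t point L x w) (m<n⇒0<n∸m (inc w 0 (s≤s z≤n))))

-- The exponent k - ℓ - 1 layer by layer: a non-final layer of size 1 contributes 1, a layer of any
-- other kind one less than its size.
degree : List ℕ → ℕ
degree []                     = 0
degree (s ∷ [])               = s ∸ 1
degree (0 ∷ t ∷ ss)           = degree (t ∷ ss)
degree (1 ∷ t ∷ ss)           = 1 + degree (t ∷ ss)
degree (suc (suc s) ∷ t ∷ ss) = suc s + degree (t ∷ ss)

family : ℕ → List ℕ → Family
family L []                     = point
family L (s ∷ [])               = approaches (s ∸ 1) point L
family L (0 ∷ t ∷ ss)           = family L (t ∷ ss)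
family L (1 ∷ t ∷ ss)           = Depart.copies (family L (t ∷ ss)) L
family L (suc (suc s) ∷ t ∷ ss) = approaches (suc s) (family L (t ∷ ss)) L

family-avoids : ∀ L s ss → All (1 ≤_) (s ∷ ss) → Avoids (family L (s ∷ ss)) (s ∷ ss)
family-avoids L zero          []       (() ∷ _)
family-avoids L (suc s)       []       _        = approaches-point-avoids s L
family-avoids L (suc zero)    (t ∷ ss) (_ ∷ ps) = Depart.depart-avoids (family L (t ∷ ss)) L {t ∷ ss} (family-avoids L t ss ps)
family-avoids L (suc (suc s)) (t ∷ ss) (_ ∷ ps) = approaches-avoids (suc s) (family L (t ∷ ss)) L {t ∷ ss} (family-avoids L t ss ps)

approaches-size : ∀ t F L → size (approaches t F L) ≡ L ^ t * size F
approaches-size zero    F L = sym (*-identityˡ (size F))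
approaches-size (suc t) F L = trans (cong (L *_) (approaches-size t F L)) (sym (*-assoc L (L ^ t) (size F)))

approaches-span : ∀ t F L → span (approaches t F L) ≡ span F * (4 ^ L) ^ t
approaches-span zero    F L = sym (*-identityʳ (span F))
approaches-span (suc t) F L = trans (cong (_* 4 ^ L) (approaches-span t F L))
  (trans (*-assoc (span F) ((4 ^ L) ^ t) (4 ^ L)) (cong (span F *_) (*-comm ((4 ^ L) ^ t) (4 ^ L))))

family-size : ∀ L ss → size (family L ss) ≡ L ^ degree ss
family-size L []                     = refl
family-size L (s ∷ [])               = trans (approaches-size (s ∸ 1) point L) (*-identityʳ _)
family-size L (0 ∷ t ∷ ss)           = family-size L (t ∷ ss)
family-size L (1 ∷ t ∷ ss)           = cong (L *_) (family-size L (t ∷ ss))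
family-size L (suc (suc s) ∷ t ∷ ss) = trans (approaches-size (suc s) (family L (t ∷ ss)) L)
  (trans (cong (L ^ suc s *_) (family-size L (t ∷ ss))) (sym (^-distribˡ-+-* L (suc s) _)))

family-span : ∀ L ss → span (family L ss) ≡ (4 ^ L) ^ degree ss
family-span L []                     = refl
family-span L (s ∷ [])               = trans (approaches-span (s ∸ 1) point L) (*-identityˡ _)
family-span L (0 ∷ t ∷ ss)           = family-span L (t ∷ ss)
family-span L (1 ∷ t ∷ ss)           = trans (cong (_* 4 ^ L) (family-span L (t ∷ ss))) (*-comm _ (4 ^ L))
family-span L (suc (suc s) ∷ t ∷ ss) = trans (approaches-span (suc s) (family L (t ∷ ss)) L)
  (trans (cong (_* (4 ^ L) ^ suc s) (family-span L (t ∷ ss)))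
    (trans (*-comm _ ((4 ^ L) ^ suc s)) (sym (^-distribˡ-+-* (4 ^ L) (suc s) _))))

-- Counting and logarithms

bound : List ℕ → ℕ → ℕ
bound []                 L = 0
bound (0 ∷ ss)           L = bound ss L
bound (1 ∷ ss)           L = suc (L * bound ss L)
bound (suc (suc m) ∷ ss) L = (suc (bound ss L) + suc (bound ss L)) * (suc L ^ suc m * 3)

upper : ∀ ss → All (1 ≤_) ss → Upper ss (bound ss)
upper []                 _        L (x ∷ A) _ _ _ =
  (λ _ → x) , wave (λ _ _ → here refl) (λ _ ()) tt
upper (0 ∷ ss)           (() ∷ _)
upper (1 ∷ ss)           (_ ∷ ps) = upper-one {ss} (upper ss ps)
upper (suc (suc m) ∷ ss) (_ ∷ ps) = upper-big {ss} m (upper ss ps)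

-- The 6 is 2 * 3: 2T elements per entry, and three entries of one key class that do not yet
-- suffice.
coefficient : List ℕ → ℕ
coefficient []                 = 0
coefficient (0 ∷ ss)           = coefficient ss
coefficient (1 ∷ ss)           = suc (coefficient ss)
coefficient (suc (suc m) ∷ ss) = 6 * suc (coefficient ss)

degree-suc-suc : ∀ m ss → degree (suc (suc m) ∷ ss) ≡ suc m + degree ss
degree-suc-suc m []       = sym (+-identityʳ (suc m))
degree-suc-suc m (t ∷ ss) = refl

bound-≤ : ∀ ss L → bound ss L ≤ coefficient ss * suc L ^ degree ss

suc-bound-≤ : ∀ ss L → suc (bound ss L) ≤ suc (coefficient ss) * suc L ^ degree ss
suc-bound-≤ ss L = +-mono-≤ (m^n>0 (suc L) (degree ss)) (bound-≤ ss L)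

bound-≤ []           L = z≤n
bound-≤ (0 ∷ [])     L = z≤n
bound-≤ (0 ∷ t ∷ ss) L = bound-≤ (t ∷ ss) L
bound-≤ (1 ∷ [])     L = s≤s (≤-trans (≤-reflexive (*-zeroʳ L)) z≤n)
bound-≤ (1 ∷ t ∷ ss) L = begin
  suc (L * bound (t ∷ ss) L)       ≤⟨ s≤s (*-monoˡ-≤ (bound (t ∷ ss) L) (n≤1+n L)) ⟩
  suc (suc L * bound (t ∷ ss) L)   ≤⟨ +-mono-≤ (m^n>0 (suc L) (suc d)) (*-monoʳ-≤ (suc L) (bound-≤ (t ∷ ss) L)) ⟩
  suc L ^ suc d + suc L * (c * suc L ^ d) ≡⟨ eq (suc L) c (suc L ^ d) ⟩
  suc c * (suc L * suc L ^ d)      ∎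
  where
  open ≤-Reasoning
  c = coefficient (t ∷ ss)
  d = degree (t ∷ ss)
  eq : ∀ l c x → l * x + l * (c * x) ≡ (1 + c) * (l * x)
  eq = solve-∀
bound-≤ (suc (suc m) ∷ ss) L = begin
  (suc b + suc b) * (suc L ^ suc m * 3)          ≤⟨ *-monoˡ-≤ (suc L ^ suc m * 3) (+-mono-≤ (suc-bound-≤ ss L) (suc-bound-≤ ss L)) ⟩
  (suc c * x + suc c * x) * (suc L ^ suc m * 3)  ≡⟨ eq (suc c) x (suc L ^ suc m) ⟩
  6 * suc c * (suc L ^ suc m * x)                ≡⟨ cong (6 * suc c *_) (sym (^-distribˡ-+-* (suc L) (suc m) (degree ss))) ⟩
  6 * suc c * suc L ^ (suc m + degree ss)        ≡⟨ cong (λ d → 6 * suc c * suc L ^ d) (sym (degree-suc-suc m ss)) ⟩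
  6 * suc c * suc L ^ degree (suc (suc m) ∷ ss)  ∎
  where
  open ≤-Reasoning
  b = bound ss L
  c = coefficient ss
  x = suc L ^ degree ss
  eq : ∀ c x y → (c * x + c * x) * (y * 3) ≡ 6 * c * (y * x)
  eq = solve-∀

sum-degree : ∀ s ss → All (1 ≤_) (s ∷ ss) → sum (s ∷ ss) ≡ suc (degree (s ∷ ss) + nonFinalBig (s ∷ ss))
sum-degree zero          []       (() ∷ _)
sum-degree (suc s)       []       _        = cong suc refl
sum-degree (suc zero)    (t ∷ ss) (_ ∷ ps) = cong suc (sum-degree t ss ps)
sum-degree (suc (suc s)) (t ∷ ss) (_ ∷ ps) =
  trans (cong (suc (suc s) +_) (sum-degree t ss ps)) (eq s (degree (t ∷ ss)) (nonFinalBig (t ∷ ss)))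
  where
  eq : ∀ s d n → 2 + s + (1 + (d + n)) ≡ 1 + (1 + s + d + (1 + n))
  eq = solve-∀

degree-formula : ∀ s ss → All (1 ≤_) (s ∷ ss) →
  degree (s ∷ ss) ≡ sum (s ∷ ss) ∸ nonFinalBig (s ∷ ss) ∸ 1
degree-formula s ss ps = sym (trans (cong (λ k → k ∸ n ∸ 1) (sum-degree s ss ps))
  (cong (_∸ 1) (m+n∸n≡m (suc (degree (s ∷ ss))) n)))
  where n = nonFinalBig (s ∷ ss)

^-distribʳ-* : ∀ m n o → (m * n) ^ o ≡ m ^ o * n ^ o
^-distribʳ-* m n zero    = refl
^-distribʳ-* m n (suc o) = trans (cong (m * n *_) (^-distribʳ-* m n o)) (eq m n (m ^ o) (n ^ o))
  where
  eq : ∀ m n x y → m * n * (x * y) ≡ m * x * (n * y)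
  eq = solve-∀

n<2^n : ∀ n → n < 2 ^ n
n<2^n zero    = s≤s z≤n
n<2^n (suc n) = ≤-trans (+-mono-≤ (m^n>0 2 n) (n<2^n n)) (≤-reflexive (sym (2^suc n)))

n<2^1+log : ∀ n → n < 2 ^ suc ⌊log₂ n ⌋
n<2^1+log n with n <? 2 ^ suc ⌊log₂ n ⌋
... | yes n< = n<
... | no  n≮ = ⊥-elim (<-irrefl refl (subst (_≤ ⌊log₂ n ⌋) (⌊log₂[2^n]⌋≡n (suc ⌊log₂ n ⌋)) (⌊log₂⌋-mono-≤ (≮⇒≥ n≮))))

log-≥ : ∀ k {n} → 2 ^ k ≤ n → k ≤ ⌊log₂ n ⌋
log-≥ k 2^k≤n = subst (_≤ _) (⌊log₂[2^n]⌋≡n k) (⌊log₂⌋-mono-≤ 2^k≤n)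

2^log≤n : ∀ n → 1 ≤ n → 2 ^ ⌊log₂ n ⌋ ≤ n
2^log≤n = <-rec _ go
  where
  open Data.Nat using (⌊_/2⌋; ⌈_/2⌉)
  go : ∀ n → (∀ {m} → m < n → 1 ≤ m → 2 ^ ⌊log₂ m ⌋ ≤ m) → 1 ≤ n → 2 ^ ⌊log₂ n ⌋ ≤ n
  go (suc zero)    rec _ = s≤s z≤n
  go (suc (suc n)) rec _ = begin
    2 ^ ⌊log₂ k ⌋             ≡⟨ cong (2 ^_) (sym (m+[n∸m]≡n (log-≥ 1 {k} (s≤s (s≤s z≤n))))) ⟩
    2 ^ suc (⌊log₂ k ⌋ ∸ 1)   ≡⟨ cong (λ l → 2 ^ suc l) (sym (⌊log₂⌊n/2⌋⌋≡⌊log₂n⌋∸1 k)) ⟩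
    2 ^ suc ⌊log₂ ⌊ k /2⌋ ⌋   ≤⟨ *-monoʳ-≤ 2 (rec (⌊n/2⌋<n (suc n)) (s≤s z≤n)) ⟩
    2 * ⌊ k /2⌋               ≡⟨ cong (⌊ k /2⌋ +_) (+-identityʳ ⌊ k /2⌋) ⟩
    ⌊ k /2⌋ + ⌊ k /2⌋         ≤⟨ +-monoʳ-≤ ⌊ k /2⌋ (⌊n/2⌋≤⌈n/2⌉ k) ⟩
    ⌊ k /2⌋ + ⌈ k /2⌉         ≡⟨ ⌊n/2⌋+⌈n/2⌉≡n k ⟩
    k                         ∎
    where
    open ≤-Reasoning
    k = suc (suc n)

elements : ∀ {n} → Subset n → List (Fin n)
elements []          = []
elements (true  ∷ p) = map Fin.suc (elements p) ++ Fin.zero ∷ []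
elements (false ∷ p) = map Fin.suc (elements p)

elements-∈ : ∀ {n} (p : Subset n) {i} → i ∈ elements p → i Subset.∈ p
elements-∈ (true ∷ p) i∈ with ∈-++⁻ (map Fin.suc (elements p)) i∈
... | inj₂ (here refl) = here
... | inj₁ i∈′ with ∈-map⁻ Fin.suc i∈′
...   | j , j∈ , refl = there (elements-∈ p j∈)
elements-∈ (false ∷ p) i∈ with ∈-map⁻ Fin.suc i∈
... | j , j∈ , refl = there (elements-∈ p j∈)

elements-length : ∀ {n} (p : Subset n) → length (elements p) ≡ ∣ p ∣
elements-length []          = refl
elements-length (true ∷ p)  = trans (length-++ (map Fin.suc (elements p)))
  (trans (+-comm _ 1) (cong suc (trans (length-map Fin.suc (elements p)) (elements-length p))))
elements-length (false ∷ p) = trans (length-map Fin.suc (elements p)) (elements-length p)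

Descending : ∀ {n} → List (Fin n) → Set
Descending = AllPairs (λ i j → toℕ i > toℕ j)

elements-descending : ∀ {n} (p : Subset n) → Descending (elements p)
elements-descending []          = []
elements-descending (true ∷ p)  = AllPairs.++⁺
  (AllPairs.map⁺ (AllPairs.map s≤s (elements-descending p))) ([] ∷ [])
  (All.map⁺ (All.universal (λ _ → s≤s z≤n ∷ []) (elements p)))
elements-descending (false ∷ p) = AllPairs.map⁺ (AllPairs.map s≤s (elements-descending p))

-- A list of indices can hold a subset of [n] as well as a color class, so both upper bounds start
-- here.
findWave : ∀ {n} ss → All (1 ≤_) ss → ∀ L → n ≤ 2 ^ L → (is : List (Fin n)) → Descending is →
  bound ss L < length is → Σ (Fin (suc (sum ss)) → Fin n) λ x → IsWave (layered ss) x × ∀ i → x i ∈ is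
findWave {n} ss ps L n≤ is desc large =
  _ , wave⇒IsWave ss w z<n , λ i → mem′ (toℕ i) (≤-pred (toℕ<n i))
  where
  member : ∀ {v} → v ∈ map toℕ is → Σ (Fin n) λ i → i ∈ is × v ≡ toℕ i
  member = ∈-map⁻ toℕ
  <n : ∀ {v} → v ∈ map toℕ is → v < n
  <n v∈ with member v∈
  ... | i , _ , refl = toℕ<n i
  found = upper ss ps L (map toℕ is) (AllPairs.map⁺ desc)
    (λ {y} _ z∈ → <-≤-trans (<n z∈) (≤-trans n≤ (m≤n+m _ y)))
    (subst (bound ss L <_) (sym (length-map toℕ is)) large)
  w = proj₂ found
  z<n : ∀ i → i ≤ sum ss → proj₁ found i < n
  z<n i i≤ = <n (mem w i i≤)
  mem′ : ∀ i (i≤ : i ≤ sum ss) → fromℕ< (z<n i i≤) ∈ is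
  mem′ i i≤ with member (mem w i i≤)
  ... | j , j∈ , eq = subst (_∈ is) (toℕ-injective (trans (sym eq) (sym (toℕ-fromℕ< (z<n i i≤))))) j∈

-- Upper bounds for g and P

module UpperBounds (s : ℕ) (ss : List ℕ) (ps : All (1 ≤_) (s ∷ ss)) where

  private
    π = s ∷ ss
    d = degree π
    c₀ = coefficient π

  -- With `l = ⌊log₂ n ⌋` the interval has length below 2^(l+1), so `suc L` becomes `2 + l`; as
  -- `n ≥ 2`, this is at most `3 * l`, whence `3 ^ d`.
  waveFree-small : ∀ n → 2 ≤ n → (A : Subset n) → WaveFree (layered π) A →
    ∣ A ∣ ≤ c₀ * 3 ^ d * ⌊log₂ n ⌋ ^ d
  waveFree-small n 2≤n A free = begin
    ∣ A ∣                          ≤⟨ ≮⇒≥ (λ large → free (contains large)) ⟩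
    bound π (suc l)                ≤⟨ bound-≤ π (suc l) ⟩
    c₀ * (2 + l) ^ d               ≤⟨ *-monoʳ-≤ c₀ (^-monoˡ-≤ d 2+l≤) ⟩
    c₀ * (3 * l) ^ d               ≡⟨ cong (c₀ *_) (^-distribʳ-* 3 l d) ⟩
    c₀ * (3 ^ d * l ^ d)           ≡⟨ sym (*-assoc c₀ (3 ^ d) (l ^ d)) ⟩
    c₀ * 3 ^ d * l ^ d             ∎
    where
    open ≤-Reasoning
    l = ⌊log₂ n ⌋
    1≤l : 1 ≤ l
    1≤l = log-≥ 1 2≤n
    2+l≤ : 2 + l ≤ 3 * l
    2+l≤ = ≤-trans (+-monoˡ-≤ l (*-monoʳ-≤ 2 1≤l)) (≤-reflexive (+-comm (2 * l) l))
    contains : bound π (suc l) < ∣ A ∣ → ContainsWave (layered π) A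
    contains large =
      let x , isW , x∈ = findWave π ps (suc l) (<⇒≤ (n<2^1+log n)) (elements A) (elements-descending A)
            (subst (bound π (suc l) <_) (sym (elements-length A)) large)
      in  x , isW , λ i → elements-∈ A (x∈ i)

  colorings-large : ∀ r → 2 ^ suc (suc (c₀ * (4 + d) ^ d)) ≤ r →
    (col : Fin (suc (c₀ * (4 + d) ^ d) * (r * ⌊log₂ r ⌋ ^ d)) → Fin r) → MonoWave (layered π) col
  colorings-large r R≤r col =
    let is , desc , _ , same , large = pigeonhole (toℕ ∘ col) r (bound π L) (elements Subset.⊤)
          (elements-descending Subset.⊤) (λ _ → toℕ<n _)
          (<-≤-trans r*bound<M (≤-reflexive (sym (trans (elements-length (Subset.⊤ {M})) (∣⊤∣≡n M)))))
        x , isW , x∈ = findWave π ps L M≤ is desc large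
    in  x , isW , λ i → toℕ-injective (same (x∈ i) (x∈ Fin.zero))
    where
    open ≤-Reasoning
    l = ⌊log₂ r ⌋
    k = c₀ * (4 + d) ^ d
    M = suc k * (r * l ^ d)
    -- One summand for each factor of `M`: `suc k ≤ 2 ^ l`, `r ≤ 2 ^ suc l` and
    -- `l ^ d ≤ 2 ^ (l * d)`.
    L = l + (suc l + l * d)
    k<l : suc (suc k) ≤ l
    k<l = log-≥ (suc (suc k)) R≤r
    1≤l : 1 ≤ l
    1≤l = ≤-trans (s≤s z≤n) k<l
    M≤ : M ≤ 2 ^ L
    M≤ = begin
      suc k * (r * l ^ d)                  ≤⟨ *-mono-≤ (≤-trans (<⇒≤ k<l) (<⇒≤ (n<2^n l)))
                                               (*-mono-≤ (<⇒≤ (n<2^1+log r)) (^-monoˡ-≤ d (<⇒≤ (n<2^n l)))) ⟩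
      2 ^ l * (2 ^ suc l * (2 ^ l) ^ d)    ≡⟨ cong (λ x → 2 ^ l * (2 ^ suc l * x)) (^-*-assoc 2 l d) ⟩
      2 ^ l * (2 ^ suc l * 2 ^ (l * d))    ≡⟨ cong (2 ^ l *_) (sym (^-distribˡ-+-* 2 (suc l) (l * d))) ⟩
      2 ^ l * 2 ^ (suc l + l * d)          ≡⟨ sym (^-distribˡ-+-* 2 l (suc l + l * d)) ⟩
      2 ^ L                                ∎
    sucL≤ : suc L ≤ (4 + d) * l
    sucL≤ = ≤-trans (≤-reflexive (eq₁ l d)) (≤-trans (+-monoˡ-≤ (2 * l + d * l) (*-monoʳ-≤ 2 1≤l)) (≤-reflexive (eq₂ l d)))
      where
      eq₁ : ∀ l d → 1 + (l + (1 + l + l * d)) ≡ 2 * 1 + (2 * l + d * l)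
      eq₁ = solve-∀
      eq₂ : ∀ l d → 2 * l + (2 * l + d * l) ≡ (4 + d) * l
      eq₂ = solve-∀
    -- The factor `k` already covers the bound for all color classes together; `suc k` makes the
    -- inequality strict.
    r*bound<M : r * bound π L < M
    r*bound<M = begin-strict
      r * bound π L                ≤⟨ *-monoʳ-≤ r (bound-≤ π L) ⟩
      r * (c₀ * suc L ^ d)         ≤⟨ *-monoʳ-≤ r (*-monoʳ-≤ c₀ (^-monoˡ-≤ d sucL≤)) ⟩
      r * (c₀ * ((4 + d) * l) ^ d) ≡⟨ cong (λ x → r * (c₀ * x)) (^-distribʳ-* (4 + d) l d) ⟩
      r * (c₀ * ((4 + d) ^ d * l ^ d)) ≡⟨ eq r c₀ ((4 + d) ^ d) (l ^ d) ⟩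
      k * (r * l ^ d)              <⟨ m<n+m (k * (r * l ^ d)) (*-mono-≤ (≤-trans (m^n>0 2 (2 + k)) R≤r) (m^n>0 l {{>-nonZero 1≤l}} d)) ⟩
      M                            ∎
      where
      eq : ∀ r c x y → r * (c * (x * y)) ≡ c * x * (r * y)
      eq = solve-∀

-- Sets and colorings without waves

insert : ∀ {n} → Fin n → Subset n → Subset n
insert Fin.zero    (_ ∷ p) = true ∷ p
insert (Fin.suc i) (b ∷ p) = b ∷ insert i p

insert-∈ : ∀ {n} i {j} (p : Subset n) → j Subset.∈ insert i p → j ≡ i ⊎ j Subset.∈ p
insert-∈ Fin.zero    (_ ∷ p) here       = inj₁ refl
insert-∈ Fin.zero    (_ ∷ p) (there j∈) = inj₂ (there j∈)
insert-∈ (Fin.suc i) (_ ∷ p) here       = inj₂ here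
insert-∈ (Fin.suc i) (_ ∷ p) (there j∈) with insert-∈ i p j∈
... | inj₁ refl = inj₁ refl
... | inj₂ j∈p  = inj₂ (there j∈p)

∣insert∣ : ∀ {n} i (p : Subset n) → i Subset.∉ p → ∣ insert i p ∣ ≡ suc ∣ p ∣
∣insert∣ Fin.zero    (true ∷ p)  i∉ = ⊥-elim (i∉ here)
∣insert∣ Fin.zero    (false ∷ p) i∉ = refl
∣insert∣ (Fin.suc i) (true ∷ p)  i∉ = cong suc (∣insert∣ i p (i∉ ∘ there))
∣insert∣ (Fin.suc i) (false ∷ p) i∉ = ∣insert∣ i p (i∉ ∘ there)

image : ∀ {m n} (f : Fin m → Fin n) → (∀ {i j} → f i ≡ f j → i ≡ j) →
  Σ (Subset n) λ A → ∣ A ∣ ≡ m × (∀ {v} → v Subset.∈ A → Σ (Fin m) λ i → f i ≡ v)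
image {zero} {n} f inj = Subset.⊥ , ∣⊥∣≡0 n , λ v∈ → ⊥-elim (∉⊥ v∈)
image {suc m} f inj =
  let A , ∣A∣ , A⊆ = image (f ∘ Fin.suc) (Fin-suc-injective ∘ inj)
      f0∉ : f Fin.zero Subset.∉ A
      f0∉ f0∈ = Fin-0≢1+n (sym (inj (proj₂ (A⊆ f0∈))))
  in  insert (f Fin.zero) A , trans (∣insert∣ (f Fin.zero) A f0∉) (cong suc ∣A∣) ,
      λ v∈ → back (insert-∈ (f Fin.zero) A v∈) A⊆
  where
  back : ∀ {v A} → v ≡ f Fin.zero ⊎ v Subset.∈ A → (∀ {v} → v Subset.∈ A → Σ (Fin m) λ i → f (Fin.suc i) ≡ v) →
    Σ (Fin (suc m)) λ i → f i ≡ v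
  back (inj₁ refl) _  = Fin.zero , refl
  back (inj₂ v∈)   A⊆ = let i , eq = A⊆ v∈ in Fin.suc i , eq

-- With s > ρ, two points ρ + s(2e) and ρ′ + s(2e′) are ordered as e and e′, and a gap
-- changes by less than s from s(2h) to g; so strict comparisons of gaps g become weak
-- comparisons of gaps h.
gaps-coarsen : ∀ {s g g′ h h′ ρ₁ ρ₁′ ρ₂ ρ₂′} → ρ₁ < s → ρ₂′ < s →
  g + ρ₁ ≡ ρ₁′ + s * (h + h) → g′ + ρ₂ ≡ ρ₂′ + s * (h′ + h′) → g < g′ → h ≤ h′
gaps-coarsen {s} {g} {g′} {h} {h′} {ρ₁} {ρ₁′} {ρ₂} {ρ₂′} ρ₁< ρ₂< e e′ g<g′ with h ≤? h′
... | yes h≤ = h≤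
... | no  h≰ = ⊥-elim (<-asym g<g′ (lin-≤ (ρ₁′ + ρ₂ + 1)
  (+-mono-≤ (+-mono-≤ ρ₁< ρ₂<) (+-mono-≤ (≤-reflexive (sym e)) (+-mono-≤ (≤-reflexive e′)
    (*-monoʳ-≤ s (+-mono-≤ (≰⇒> h≰) (≰⇒> h≰))))))
  (eq s g g′ h h′ ρ₁ ρ₁′ ρ₂ ρ₂′)))
  where
  eq : ∀ s g g′ h h′ ρ₁ ρ₁′ ρ₂ ρ₂′ →
    suc g′ + (s + s + (g + ρ₁ + (ρ₂′ + s * (h′ + h′) + s * (h + h)))) + (ρ₁′ + ρ₂ + 1) ≡
    g + (suc ρ₁ + suc ρ₂′ + (ρ₁′ + s * (h + h) + (g′ + ρ₂ + s * (suc h′ + suc h′))))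
  eq = solve-∀

-- Every color class is a translate of 2 s A with the i-th element moved up by i, where
-- A = {a₀, …, a₍ₛ₋₁₎} ⊆ [0,n): the points with residue i modulo s take their color from aᵢ,
-- so the translates by multiples of s tile.
module TranslateColoring (F : Family) (ss : List ℕ) (ps : All (1 ≤_) ss) (av : Avoids F ss)
                         .{{_ : NonZero (size F)}} (r : ℕ) (2n≤r : span F + span F ≤ r) where

  private
    s = size F
    n = span F

  M : ℕ
  M = (r ∸ (n + n)) * s

  a : ℕ → ℕ
  a x = el F (x mod s)

  -- Using `n ∸ a x` for the negative of `a x` stays in the naturals. The shift is at most 2n, and
  -- `M` contains only `r ∸ (n + n)` blocks of length `s`, which keeps colors below `r`.
  color : ℕ → ℕ
  color x = x / s + ((n ∸ a x) + (n ∸ a x))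

  color< : ∀ {x} → x < M → color x < r
  color< {x} x<M = <-≤-trans (+-mono-<-≤ (m<n*o⇒m/o<n {x} {r ∸ (n + n)} {s} x<M) (+-mono-≤ (m∸n≤m n (a x)) (m∸n≤m n (a x))))
    (≤-reflexive (m∸n+n≡m 2n≤r))

  coloring : Fin M → Fin r
  coloring i = fromℕ< (color< (toℕ<n i))

  color-eq : ∀ x → x + s * (n + n) ≡ x % s + s * (a x + a x) + s * color x
  color-eq x = trans (cong₂ (λ x n → x + s * (n + n)) (m≡m%n+[m/n]*n x s) (sym (m∸n+n≡m (<⇒≤ (bounded F (x mod s))))))
    (eq (x % s) (x / s) s (a x) (n ∸ a x))
    where
    eq : ∀ ρ q s a b → ρ + q * s + s * (b + a + (b + a)) ≡ ρ + s * (a + a) + s * (q + (b + b))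
    eq = solve-∀

  module _ {x x′} (same : color x ≡ color x′) (x<x′ : x < x′) where

    -- Equal elements have equal residues by injectivity, and then `color-eq` identifies the points;
    -- a drop in `a` lowers the point by at least 2s, which residues below `s` cannot offset.
    a< : a x < a x′
    a< with <-cmp (a x) (a x′)
    ... | tri< lt _ _ = lt
    ... | tri≈ _ eq _ = ⊥-elim (<-irrefl (+-cancelʳ-≡ (s * (n + n)) x x′ (trans (color-eq x)
          (trans (cong₂ _+_ (cong₂ (λ ρ a → ρ + s * (a + a)) ρ≡ eq) (cong (s *_) same)) (sym (color-eq x′))))) x<x′)
      where
      ρ≡ : x % s ≡ x′ % s
      ρ≡ = trans (sym (toℕ-fromℕ< (m%n<n x s))) (trans (cong toℕ (injective F eq)) (toℕ-fromℕ< (m%n<n x′ s)))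
    ... | tri> _ _ gt = ⊥-elim (<-irrefl refl (lin-≤ (x % s + s + 1)
          (+-mono-≤ x<x′ (+-mono-≤ (m%n<n x′ s) (+-mono-≤ (*-monoʳ-≤ s (+-mono-≤ gt gt))
            (+-mono-≤ (≤-reflexive (sym (color-eq x))) (≤-reflexive (trans (color-eq x′) (cong (λ c → x′ % s + s * (a x′ + a x′) + s * c) (sym same))))))))
          (eq x x′ (x % s) (x′ % s) s (a x) (a x′) (n + n) (color x))))
      where
      eq : ∀ x x′ ρ ρ′ s a a′ N c →
        suc x + (x′ + (s + (s * (a + a) + (x + s * N + (ρ′ + s * (a′ + a′) + s * c))))) + (ρ + s + 1) ≡
        x + (suc x + (suc ρ′ + (s * (suc a′ + suc a′) + (ρ + s * (a + a) + s * c + (x′ + s * N)))))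
      eq = solve-∀

    gap-eq : (x′ ∸ x) + x % s ≡ x′ % s + s * ((a x′ ∸ a x) + (a x′ ∸ a x))
    gap-eq = +-cancelʳ-≡ (s * (a x + a x) + s * color x) _ _ (begin
      (x′ ∸ x) + x % s + (s * (a x + a x) + s * color x)   ≡⟨ eq₁ (x′ ∸ x) (x % s) (s * (a x + a x)) (s * color x) ⟩
      (x′ ∸ x) + (x % s + s * (a x + a x) + s * color x)   ≡⟨ cong ((x′ ∸ x) +_) (sym (color-eq x)) ⟩
      (x′ ∸ x) + (x + s * (n + n))                         ≡⟨ sym (+-assoc (x′ ∸ x) x (s * (n + n))) ⟩
      (x′ ∸ x) + x + s * (n + n)                           ≡⟨ cong (_+ s * (n + n)) (m∸n+n≡m (<⇒≤ x<x′)) ⟩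
      x′ + s * (n + n)                                     ≡⟨ color-eq x′ ⟩
      x′ % s + s * (a x′ + a x′) + s * color x′            ≡⟨ cong₂ (λ a c → x′ % s + s * (a + a) + s * c) (sym (m∸n+n≡m (<⇒≤ a<))) (sym same) ⟩
      x′ % s + s * (h + a x + (h + a x)) + s * color x     ≡⟨ eq₂ (x′ % s) s h (a x) (s * color x) ⟩
      x′ % s + s * (h + h) + (s * (a x + a x) + s * color x) ∎)
      where
      open ≡-Reasoning
      h = a x′ ∸ a x
      eq₁ : ∀ g ρ a c → g + ρ + (a + c) ≡ g + (ρ + a + c)
      eq₁ = solve-∀
      eq₂ : ∀ ρ s h a c → ρ + s * (h + a + (h + a)) + c ≡ ρ + s * (h + h) + (s * (a + a) + c)
      eq₂ = solve-∀

  -- A monochromatic wave projects to elements of `F`: they increase by `a<`, and `gaps-coarsen`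
  -- leaves a weak wave, which `F` avoids.
  coloring-waveFree : ¬ MonoWave (layered ss) coloring
  coloring-waveFree (x , (inc′ , gaps) , mono) =
    av _ (extend-wave ss (λ i → a (X i)) ps (λ i → X i mod s , refl) (λ i → a< (same i) (inc′ i))
      λ i j π< → gaps-coarsen (m%n<n (X (inject₁ j)) s) (m%n<n (X (Fin.suc i)) s)
        (gap-eq (same j) (inc′ j)) (gap-eq (same i) (inc′ i)) (Equivalence.from (gaps i j) π<))
    where
    X : Fin (suc (sum ss)) → ℕ
    X i = toℕ (x i)
    color₀ : ∀ i → color (X i) ≡ color (X Fin.zero)
    color₀ i = trans (sym (toℕ-fromℕ< (color< (toℕ<n (x i)))))
      (trans (cong toℕ (mono i)) (toℕ-fromℕ< (color< (toℕ<n (x Fin.zero)))))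
    same : ∀ i → color (X (inject₁ i)) ≡ color (X (Fin.suc i))
    same i = trans (color₀ (inject₁ i)) (sym (color₀ (Fin.suc i)))

m≤2[m/n]n : ∀ m n .{{_ : NonZero n}} → n ≤ m → m ≤ 2 * n * (m / n)
m≤2[m/n]n m n n≤m = begin
  m                      ≡⟨ m≡m%n+[m/n]*n m n ⟩
  m % n + m / n * n      ≤⟨ +-monoˡ-≤ (m / n * n) (<⇒≤ (m%n<n m n)) ⟩
  n + m / n * n          ≤⟨ +-monoˡ-≤ (m / n * n) (≤-trans (≤-reflexive (sym (*-identityˡ n))) (*-monoˡ-≤ n (m≥n⇒m/n>0 n≤m))) ⟩
  m / n * n + m / n * n  ≡⟨ eq (m / n) n ⟩
  2 * n * (m / n)        ∎
  where
  open ≤-Reasoning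
  eq : ∀ q n → q * n + q * n ≡ 2 * n * q
  eq = solve-∀

log-power : ∀ l K d .{{_ : NonZero K}} → K ≤ l → l ^ d ≤ (2 * K) ^ d * (l / K) ^ d
log-power l K d K≤l = ≤-trans (^-monoˡ-≤ d (m≤2[m/n]n l K K≤l)) (≤-reflexive (^-distribʳ-* (2 * K) (l / K) d))

-- Lower bounds for g and P

module LowerBounds (s : ℕ) (ss : List ℕ) (ps : All (1 ≤_) (s ∷ ss)) where

  private
    π = s ∷ ss
    d = degree π

  span-2^ : ∀ L → span (family L π) ≡ 2 ^ (2 * (L * d))
  span-2^ L = trans (family-span L π) (trans (^-*-assoc 4 L d) (^-*-assoc 2 2 (L * d)))

  waveFree-large : ∀ n → 2 ^ suc (2 * d) ≤ n → Σ (Subset n) λ A → WaveFree (layered π) A ×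
    ⌊log₂ n ⌋ ^ d ≤ (2 * suc (2 * d)) ^ d * ∣ A ∣
  waveFree-large n 2^K≤n =
    let A , ∣A∣ , A⊆ = image f λ {i} {j} eq → injective F (trans (sym (toℕ-f i)) (trans (cong toℕ eq) (toℕ-f j)))
    in  A , (λ (x , (inc′ , gaps) , x∈) → family-avoids L s ss ps _
          (extend-wave π (toℕ ∘ x) ps (λ i → let j , eq = A⊆ (x∈ i) in j , trans (sym (toℕ-f j)) (cong toℕ eq))
            inc′ λ i j π< → <⇒≤ (Equivalence.from (gaps i j) π<))) ,
        ≤-trans (log-power l K d (log-≥ K 2^K≤n))
          (≤-reflexive (cong ((2 * K) ^ d *_) (trans (sym (family-size L π)) (sym ∣A∣))))
    where
    -- The span is 2^(2dL), and `L * K ≤ l` keeps it at most `n`; the extra 1 makes the divisor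
    -- positive when `d = 0`.
    K = suc (2 * d)
    l = ⌊log₂ n ⌋
    L = l / K
    F = family L π
    span≤n : span F ≤ n
    span≤n = begin
      span F               ≡⟨ span-2^ L ⟩
      2 ^ (2 * (L * d))    ≤⟨ ^-monoʳ-≤ 2 (≤-trans (≤-trans (m≤m+n _ L) (≤-reflexive (eq L d))) (m/n*n≤m l K)) ⟩
      2 ^ l                ≤⟨ 2^log≤n n (≤-trans (m^n>0 2 K) 2^K≤n) ⟩
      n                    ∎
      where
      open ≤-Reasoning
      eq : ∀ L d → 2 * (L * d) + L ≡ L * (1 + 2 * d)
      eq = solve-∀
    f : Fin (size F) → Fin n
    f i = fromℕ< (<-≤-trans (bounded F i) span≤n)
    toℕ-f : ∀ i → toℕ (f i) ≡ el F i
    toℕ-f i = toℕ-fromℕ< (<-≤-trans (bounded F i) span≤n)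

  colorings-small : ∀ r → 2 ^ (3 + 2 * d) ≤ r → Σ ℕ λ M →
    r * ⌊log₂ r ⌋ ^ d ≤ 2 * (2 * (3 + 2 * d)) ^ d * suc M ×
    Σ (Fin M → Fin r) λ col → ¬ MonoWave (layered π) col
  colorings-small r 2^K≤r = M , large , coloring , coloring-waveFree
    where
    open ≤-Reasoning
    -- With `L ≥ 1` this gives 2 + 2dL ≤ L * K ≤ l, so four spans fit into `r` and at least half of
    -- it remains after subtracting 2n.
    K = 3 + 2 * d
    l = ⌊log₂ r ⌋
    L = l / K
    F = family L π
    K≤l : K ≤ l
    K≤l = log-≥ K 2^K≤r
    1≤L : 1 ≤ L
    1≤L = m≥n⇒m/n>0 K≤l
    instance
      size≢0 : NonZero (size F)
      size≢0 = >-nonZero (subst (0 <_) (sym (family-size L π)) (m^n>0 L {{>-nonZero 1≤L}} d))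
    n = span F
    4n≤r : 2 * (n + n) ≤ r
    4n≤r = begin
      2 * (n + n)             ≡⟨ cong (2 *_) (trans (cong (n +_) (sym (+-identityʳ n))) (cong (2 *_) (span-2^ L))) ⟩
      2 ^ (2 + 2 * (L * d))   ≤⟨ ^-monoʳ-≤ 2 (≤-trans (+-monoˡ-≤ (2 * (L * d)) (≤-trans (*-monoʳ-≤ 2 1≤L) (m≤m+n (2 * L) L)))
                                  (≤-trans (≤-reflexive (eq L d)) (m/n*n≤m l K))) ⟩
      2 ^ l                   ≤⟨ 2^log≤n r (≤-trans (m^n>0 2 K) 2^K≤r) ⟩
      r                       ∎
      where
      eq : ∀ L d → 2 * L + L + 2 * (L * d) ≡ L * (3 + 2 * d)
      eq = solve-∀
    2n≤r : n + n ≤ r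
    2n≤r = ≤-trans (m≤m+n (n + n) _) 4n≤r
    open TranslateColoring F π ps (family-avoids L s ss ps) r 2n≤r
    r≤ : r ≤ 2 * (r ∸ (n + n))
    r≤ = lin-≤ 0 (+-mono-≤ 4n≤r (+-mono-≤ (≤-reflexive (sym back)) (≤-reflexive (sym back)))) (eq r (n + n) (r ∸ (n + n)))
      where
      back : r ∸ (n + n) + (n + n) ≡ r
      back = m∸n+n≡m 2n≤r
      eq : ∀ r N t → r + (r + (t + N + (t + N))) + 0 ≡ 2 * t + (2 * N + (r + r))
      eq = solve-∀
    large : r * l ^ d ≤ 2 * (2 * K) ^ d * suc M
    large = begin
      r * l ^ d                                       ≤⟨ *-mono-≤ r≤ (log-power l K d K≤l) ⟩
      2 * (r ∸ (n + n)) * ((2 * K) ^ d * L ^ d)       ≡⟨ cong (λ m → 2 * (r ∸ (n + n)) * ((2 * K) ^ d * m)) (sym (family-size L π)) ⟩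
      2 * (r ∸ (n + n)) * ((2 * K) ^ d * size F)      ≡⟨ eq (r ∸ (n + n)) ((2 * K) ^ d) (size F) ⟩
      2 * (2 * K) ^ d * M                             ≤⟨ *-monoʳ-≤ (2 * (2 * K) ^ d) (n≤1+n M) ⟩
      2 * (2 * K) ^ d * suc M                         ∎
      where
      eq : ∀ t k m → 2 * t * (k * m) ≡ 2 * k * (t * m)
      eq = solve-∀

theorem1p16 : (ss : List ℕ) → All (1 ≤_) ss → 1 ≤ sum ss →
    (Σ ℕ λ c → Σ ℕ λ C → Σ ℕ λ N → ∀ n → N ≤ n →
    (Σ (Subset n) λ A → WaveFree (layered ss) A
    × ⌊log₂ n ⌋ ^ (sum ss ∸ nonFinalBig ss ∸ 1) ≤ c * ∣ A ∣)
    × (∀ (A : Subset n) → WaveFree (layered ss) A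
    → ∣ A ∣ ≤ C * ⌊log₂ n ⌋ ^ (sum ss ∸ nonFinalBig ss ∸ 1)))
    ×
    (Σ ℕ λ c → Σ ℕ λ C → Σ ℕ λ R → ∀ r → R ≤ r →
    (Σ ℕ λ M → M ≤ C * (r * ⌊log₂ r ⌋ ^ (sum ss ∸ nonFinalBig ss ∸ 1))
    × (∀ (col : Fin M → Fin r) → MonoWave (layered ss) col))
    × (Σ ℕ λ M → r * ⌊log₂ r ⌋ ^ (sum ss ∸ nonFinalBig ss ∸ 1) ≤ c * suc M
    × Σ (Fin M → Fin r) λ col → ¬ MonoWave (layered ss) col))
theorem1p16 [] _ ()
theorem1p16 (s ∷ ss) ps _ rewrite sym (degree-formula s ss ps) =
  ((2 * suc (2 * d)) ^ d , coefficient π * 3 ^ d , 2 + 2 ^ suc (2 * d) , λ n N≤n →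
    LowerBounds.waveFree-large s ss ps n (≤-trans (m≤n+m _ 2) N≤n) ,
    UpperBounds.waveFree-small s ss ps n (≤-trans (m≤m+n 2 _) N≤n)) ,
  (2 * (2 * (3 + 2 * d)) ^ d , suc k , 2 ^ suc (suc k) + 2 ^ (3 + 2 * d) , λ r R≤r →
    (suc k * (r * ⌊log₂ r ⌋ ^ d) , ≤-refl , UpperBounds.colorings-large s ss ps r (≤-trans (m≤m+n _ _) R≤r)) ,
    LowerBounds.colorings-small s ss ps r (≤-trans (m≤n+m _ (2 ^ suc (suc k))) R≤r))
  where
  π = s ∷ ss
  d = degree π
  k = coefficient π * (4 + d) ^ d
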